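{- Let $G$ be a $\emptyset$-definable group in a monster model $\mathfrak C$, let $X\subseteq G$ be a $\emptyset$-definable approximate subgroup, and let $H:=\langle X\rangle$ be the subgroup generated by $X$. The following conditions are equivalent: \begin{enumerate} \item $H^{000}_\emptyset=H^{00}_\emptyset$. \item There is $m\geq1$ such that $H^{00}_\emptyset\subseteq Y^m$ for every $\emptyset$-definable, generic, symmetric subset $Y$ of $H$. \item There is $m\geq1$ such that $H^{000}_\emptyset\subseteq Y^m$ for every $\emptyset$-definable, generic, symmetric subset $Y$ of $H$. \end{enumerate}
   Context: A monster model is $\kappa$-saturated and strongly $\kappa$-homogeneous for a sufficiently large cardinal $\kappa$; bounded means of cardinality $<\kappa$. A set $Y$ is symmetric if $Y=Y^{ -1}$ and $1\in Y$. An approximate subgroup is a symmetric subset $X$ such that $X^2=XX$ is contained in finitely many left translates of $X$. $Y^m$ is the $m$-fold product set. A definable subset $D$ of $H$ is generic if finitely many left translates of $D$ by elements of $H$ cover $X$. $H^{000}_\emptyset$ is the smallest $\mathrm{Aut}(\mathfrak C)$-invariant subgroup of $H$ of bounded index (it always exists). $H^{00}_\emptyset$ is the smallest $\emptyset$-type-definable subgroup of $H$ of bounded index; it exists if and only if $H$ contains some $\emptyset$-type-definable subgroup of bounded index, which need not be the case. Conditions (1) and (2) are understood to include the existence of $H^{00}_\emptyset$. -}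

module Defs where

open import Level using (Level) renaming (suc to lsuc)
open import Algebra.Bundles using (Group)
open import Algebra.Structures using (IsGroup)
import Algebra.Properties.Group as GroupProperties
open import Data.Bool.Base using (Bool)
open import Data.Fin.Base using (Fin)
open import Data.List.Base using (List)
open import Data.List.Relation.Unary.All using (All)
open import Data.List.Relation.Unary.Any using (Any)
open import Data.Nat.Base using (ℕ; zero; suc; _+_)
open import Data.Product.Base using (Σ; ∃; _×_; _,_; proj₁)
open import Data.Vec.Base using (Vec; []; _∷_; _++_; lookup; map)
open import Function.Bundles using (Injection; Inverse; _↔_; _⇔_)
open import Relation.Binary.Bundles using (Setoid)
open import Relation.Binary.Core using (Rel)
open import Relation.Binary.Definitions using (_Respects_)
open import Relation.Binary.PropositionalEquality using (_≡_; setoid; _→-setoid_)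
import Relation.Binary.Construct.On as On
open import Relation.Nullary.Negation using (¬_)
open import Relation.Unary using (Pred; _∈_; _⊆_; _≐_)

private
  variable
    ℓ a b c d : Level
    n k : ℕ

-- |A| < |B|.  Sets are setoids here so that quotients have a cardinality.
infix 4 _<ᶜ_
_<ᶜ_ : Setoid a b → Setoid c d → Set _
A <ᶜ B = Injection A B × ¬ Injection B A

subsetSetoid : {A : Set a} → Pred A b → Setoid _ _
subsetSetoid {A = A} P = On.setoid (setoid A) (proj₁ {B = P})

record Language (ℓ : Level) : Set (lsuc ℓ) where
  field
    Fun : ℕ → Set ℓ
    Pre : ℕ → Set ℓ

module Syntax (L : Language ℓ) where
  open Language L

  data Term (n : ℕ) : Set ℓ where
    var : Fin n → Term n
    app : Fun k → Vec (Term n) k → Term n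

  -- `ex` binds variable zero.
  data Formula (n : ℕ) : Set ℓ where
    eq  : Term n → Term n → Formula n
    pre : Pre k → Vec (Term n) k → Formula n
    neg : Formula n → Formula n
    and : Formula n → Formula n → Formula n
    ex  : Formula (suc n) → Formula n

record Structure (L : Language ℓ) : Set (lsuc ℓ) where
  open Language L
  field
    Dom  : Set ℓ
    funᴵ : Fun k → Vec Dom k → Dom
    preᴵ : Pre k → Pred (Vec Dom k) ℓ

module Semantics {L : Language ℓ} (𝔐 : Structure L) where
  open Language L
  open Syntax L public
  open Structure 𝔐 public

  mutual
    eval : Vec Dom n → Term n → Dom
    eval ρ (var i)    = lookup ρ i
    eval ρ (app f ts) = funᴵ f (evals ρ ts)

    evals : Vec Dom n → Vec (Term n) k → Vec Dom k
    evals ρ []       = []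
    evals ρ (t ∷ ts) = eval ρ t ∷ evals ρ ts

  infix 4 _⊨_
  _⊨_ : Vec Dom n → Formula n → Set ℓ
  ρ ⊨ eq s t   = eval ρ s ≡ eval ρ t
  ρ ⊨ pre R ts = preᴵ R (evals ρ ts)
  ρ ⊨ neg φ    = ¬ (ρ ⊨ φ)
  ρ ⊨ and φ ψ  = (ρ ⊨ φ) × (ρ ⊨ ψ)
  ρ ⊨ ex φ     = ∃ λ x → (x ∷ ρ) ⊨ φ

  record Automorphism : Set ℓ where
    field
      bijection : Dom ↔ Dom
    open Inverse bijection public using (to; from)
    field
      fun-preserved : (f : Fun k) (xs : Vec Dom k) →
                      to (funᴵ f xs) ≡ funᴵ f (map to xs)
      pre-preserved : (R : Pre k) (xs : Vec Dom k) →
                      preᴵ R xs ⇔ preᴵ R (map to xs)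

  -- The last `arity` variables of `formula` stand for the parameters.
  record FormulaOver (A : Pred Dom ℓ) (n : ℕ) : Set ℓ where
    field
      {arity} : ℕ
      formula : Formula (n + arity)
      params  : Vec (Σ Dom A) arity

  infix 4 _⊨ₚ_
  _⊨ₚ_ : {A : Pred Dom ℓ} → Vec Dom n → FormulaOver A n → Set ℓ
  x ⊨ₚ φ = (x ++ map proj₁ params) ⊨ formula
    where open FormulaOver φ

  FinitelySatisfiable : {A : Pred Dom ℓ} → Pred (FormulaOver A n) ℓ → Set ℓ
  FinitelySatisfiable Γ =
    ∀ φs → All (_∈ Γ) φs → ∃ λ x → All (x ⊨ₚ_) φs

  Realised : {A : Pred Dom ℓ} → Pred (FormulaOver A n) ℓ → Set ℓ
  Realised Γ = ∃ λ x → ∀ φ → φ ∈ Γ → x ⊨ₚ φ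

  Elementary : (A : Pred Dom ℓ) → (Σ Dom A → Dom) → Set ℓ
  Elementary A f = ∀ {k} (φ : Formula k) (as : Vec (Σ Dom A) k) →
                   (map proj₁ as ⊨ φ) ⇔ (map f as ⊨ φ)

  -- A cardinal κ is given by a set of that cardinality.
  Saturated : Set ℓ → Set (lsuc ℓ)
  Saturated κ =
    (A : Pred Dom ℓ) → subsetSetoid A <ᶜ setoid κ →
    ∀ {n} (Γ : Pred (FormulaOver A n) ℓ) → FinitelySatisfiable Γ → Realised Γ

  StronglyHomogeneous : Set ℓ → Set (lsuc ℓ)
  StronglyHomogeneous κ =
    (A : Pred Dom ℓ) → subsetSetoid A <ᶜ setoid κ →
    (f : Σ Dom A → Dom) → Elementary A f →
    ∃ λ (σ : Automorphism) → ∀ x → Automorphism.to σ (proj₁ x) ≡ f x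

  -- "Sufficiently large" is read as 2^(|L| + ℵ₀) < κ; the set of all
  -- formulas has cardinality |L| + ℵ₀.
  record IsMonster (κ : Set ℓ) : Set (lsuc ℓ) where
    field
      large       : (∃ Formula →-setoid Bool) <ᶜ setoid κ
      saturated   : Saturated κ
      homogeneous : StronglyHomogeneous κ

private
  module CosetLemmas {a b : Level} (G : Group a b) where
    open Group G
    open GroupProperties G using (⁻¹-anti-homo-∙; ⁻¹-involutive)

    ε≈x⁻¹x : ∀ x → ε ≈ x ⁻¹ ∙ x
    ε≈x⁻¹x x = sym (inverseˡ x)

    inv-diff : ∀ x y → (x ⁻¹ ∙ y) ⁻¹ ≈ y ⁻¹ ∙ x
    inv-diff x y =
      trans (⁻¹-anti-homo-∙ (x ⁻¹) y) (∙-congˡ (⁻¹-involutive x))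

    comp-diff : ∀ x y z → (x ⁻¹ ∙ y) ∙ (y ⁻¹ ∙ z) ≈ x ⁻¹ ∙ z
    comp-diff x y z =
      trans (assoc (x ⁻¹) y (y ⁻¹ ∙ z))
        (∙-congˡ (trans (sym (assoc y (y ⁻¹) z))
          (trans (∙-congʳ (inverseʳ y)) (identityˡ z))))

record DefinableGroup {L : Language ℓ} (𝔐 : Structure L) : Set ℓ where
  open Semantics 𝔐
  field
    dim     : ℕ
    carrier : Formula dim

  Elem : Set ℓ
  Elem = Σ (Vec Dom dim) (_⊨ carrier)

  infix 4 _≈_
  _≈_ : Rel Elem ℓ
  x ≈ y = proj₁ x ≡ proj₁ y

  infixl 7 _∙_
  infix  8 _⁻¹
  field
    _∙_     : Elem → Elem → Elem
    ε       : Elem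
    _⁻¹     : Elem → Elem
    isGroup : IsGroup _≈_ _∙_ ε _⁻¹
    graph   : Formula (dim + (dim + dim))
    graph-∙ : ∀ x y z → (x ∙ y ≈ z) ⇔ (proj₁ x ++ (proj₁ y ++ proj₁ z) ⊨ graph)

  group : Group ℓ ℓ
  group = record { isGroup = isGroup }

module DefinableGroupTheory {L : Language ℓ} {𝔐 : Structure L}
                            (G : DefinableGroup 𝔐) where
  open Semantics 𝔐
  open DefinableGroup G public
  open CosetLemmas group

  Subset : Set (lsuc ℓ)
  Subset = Pred Elem ℓ

  -- Definability relative to G is definability in Dom ^ dim, G being definable.
  Definable : Subset → Set ℓ
  Definable D = ∃ λ (φ : Formula dim) → ∀ x → x ∈ D ⇔ (proj₁ x ⊨ φ)

  TypeDefinable : Subset → Set (lsuc ℓ)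
  TypeDefinable D = ∃ λ (Γ : Pred (Formula dim) ℓ) →
                    ∀ x → x ∈ D ⇔ (∀ φ → φ ∈ Γ → proj₁ x ⊨ φ)

  -- Only closure under every σ is asked for; the reverse inclusion is the
  -- closure under the inverse of σ.
  Invariant : Subset → Set ℓ
  Invariant D = ∀ (σ : Automorphism) x y →
                proj₁ y ≡ map (Automorphism.to σ) (proj₁ x) → x ∈ D → y ∈ D

  infixl 7 _·_
  _·_ : Subset → Subset → Subset
  (A · B) z = ∃ λ x → ∃ λ y → x ∈ A × y ∈ B × z ≈ x ∙ y

  infixr 8 _^_
  _^_ : Subset → ℕ → Subset
  Y ^ zero  = _≈ ε
  Y ^ suc m = Y · (Y ^ m)

  inverse : Subset → Subset
  inverse Y z = ∃ λ x → x ∈ Y × z ≈ x ⁻¹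

  _⟨·⟩_ : Elem → Subset → Subset
  (g ⟨·⟩ Y) z = ∃ λ x → x ∈ Y × z ≈ g ∙ x

  Symmetric : Subset → Set ℓ
  Symmetric Y = Y ≐ inverse Y × ε ∈ Y

  CoveredBy : Subset → List Elem → Subset → Set ℓ
  CoveredBy X gs Y = ∀ {z} → z ∈ X → Any (λ g → z ∈ (g ⟨·⟩ Y)) gs

  ApproximateSubgroup : Subset → Set ℓ
  ApproximateSubgroup X = Symmetric X × ∃ λ gs → CoveredBy (X · X) gs X

  record IsSubgroup (K : Subset) : Set ℓ where
    field
      respects  : K Respects _≈_
      ε-closed  : ε ∈ K
      ∙-closed  : ∀ {x y} → x ∈ K → y ∈ K → x ∙ y ∈ K
      ⁻¹-closed : ∀ {x} → x ∈ K → x ⁻¹ ∈ K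

  data ⟨_⟩ (X : Subset) : Subset where
    incl : ∀ {x} → x ∈ X → x ∈ ⟨ X ⟩
    unit : ε ∈ ⟨ X ⟩
    mul  : ∀ {x y} → x ∈ ⟨ X ⟩ → y ∈ ⟨ X ⟩ → x ∙ y ∈ ⟨ X ⟩
    inv  : ∀ {x} → x ∈ ⟨ X ⟩ → x ⁻¹ ∈ ⟨ X ⟩
    resp : ∀ {x y} → x ≈ y → x ∈ ⟨ X ⟩ → y ∈ ⟨ X ⟩

  -- The set H / K of left cosets: xK = yK exactly when x⁻¹y ∈ K.
  cosets : (H : Subset) {K : Subset} → IsSubgroup K → Setoid ℓ ℓ
  cosets H {K} K≤ = record
    { Carrier       = Σ Elem H
    ; _≈_           = λ x y → (proj₁ x ⁻¹ ∙ proj₁ y) ∈ K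
    ; isEquivalence = record
      { refl  = λ {x} → respects (ε≈x⁻¹x (proj₁ x)) ε-closed
      ; sym   = λ {x} {y} p →
                  respects (inv-diff (proj₁ x) (proj₁ y)) (⁻¹-closed p)
      ; trans = λ {x} {y} {z} p q →
                  respects (comp-diff (proj₁ x) (proj₁ y) (proj₁ z)) (∙-closed p q)
      }
    }
    where open IsSubgroup K≤

  record BoundedIndexSubgroup (κ : Set ℓ) (H K : Subset) : Set ℓ where
    field
      isSubgroup : IsSubgroup K
      contained  : K ⊆ H
      bounded    : cosets H isSubgroup <ᶜ setoid κ

  Smallest : (Subset → Set b) → Subset → Set _
  Smallest P K = P K × (∀ K′ → P K′ → K ⊆ K′)

  -- IsH⁰⁰⁰ κ H K says that H⁰⁰⁰_∅ exists and equals K; likewise IsH⁰⁰.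
  IsH⁰⁰⁰ : (κ : Set ℓ) (H K : Subset) → Set (lsuc ℓ)
  IsH⁰⁰⁰ κ H = Smallest λ K → BoundedIndexSubgroup κ H K × Invariant K

  IsH⁰⁰ : (κ : Set ℓ) (H K : Subset) → Set (lsuc ℓ)
  IsH⁰⁰ κ H = Smallest λ K → BoundedIndexSubgroup κ H K × TypeDefinable K

  record Generic (X Y : Subset) : Set ℓ where
    field
      translates     : List Elem
      translates⊆⟨X⟩ : All (_∈ ⟨ X ⟩) translates
      covers         : CoveredBy X translates Y

{-# OPTIONS --safe #-}
-- (3) ⇒ (1).  Call a ∅-definable set fine when X can be coloured with finitely
-- many colours so that a⁻¹b lies in the set for a, b of the same colour.  Fine
-- sets are generic and closed under intersection, so by saturation the
-- intersection of the Yᵐ over all fine Y is Pᵐ, P being the intersection of all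
-- fine Y.  And P ⊆ H⁰⁰⁰: an element of P is, up to conjugacy, a⁻¹b with a and b
-- of the same type over a set of representatives of H / H⁰⁰⁰.  Hence (3) makes
-- H⁰⁰⁰ equal to the type-definable Pᵐ.  That the set of entries of the
-- representatives is small is the one place where cardinal arithmetic is
-- needed: κ is not a finite union of sets into which it does not embed.
--
-- (1) ⇒ (2).  The elements lying for some n in Yⁿ for all generic Y form an
-- invariant subgroup of bounded index, so they contain K = H⁰⁰⁰ = H⁰⁰.  If no m
-- is as in (2), one finds inductively generic Yₙ such that K minus Y₁, Y₂², …,
-- Yₙⁿ is still piecewise syndetic; by saturation some element of K avoids
-- every Yₙⁿ, which is absurd.
module Submission where

open import Defs
open import Level using (Level) renaming (suc to lsuc)
open import Algebra.Bundles using (Group)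
import Algebra.Properties.Group as GroupProperties
open import Axiom.ExcludedMiddle using (ExcludedMiddle)
open import Axiom.Extensionality.Propositional using (Extensionality)
open import Data.Bool.Base using (Bool; true; false; T)
open import Data.Empty using (⊥; ⊥-elim)
open import Data.Fin.Base as Fin using (Fin; zero; suc; toℕ; combine; _↑ˡ_; _↑ʳ_)
open import Data.Fin.Properties
  using (toℕ-injective; pigeonhole; splitAt-↑ˡ; splitAt-↑ʳ; combine-injectiveˡ; combine-injectiveʳ)
open import Data.List.Base as List using (List; []; _∷_; length; cartesianProductWith; allFin; foldr)
open import Data.List.Membership.Propositional using (find; lose) renaming (_∈_ to _∈ˡ_; _∉_ to _∉ˡ_)
open import Data.List.Membership.Propositional.Properties
  using (∈-cartesianProductWith⁺; ∈-cartesianProductWith⁻; ∈-allFin; ∈-map⁺)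
open import Data.List.Relation.Unary.All as All using (All; []; _∷_)
import Data.List.Relation.Unary.All.Properties as All
open import Data.List.Relation.Unary.Any as Any using (Any; here; there; index)
open import Data.List.Relation.Unary.Any.Properties using (lookup-index)
open import Data.Nat.Base using (ℕ; zero; suc; _+_; _<_; _≥_; s≤s; z≤n)
open import Data.Nat.Properties using (+-comm; +-suc; suc-injective; <-cmp; n<1+n; <-irrefl; <⇒≱)
open import Data.Product.Base using (Σ; ∃; _×_; _,_; proj₁; proj₂)
open import Data.Product.Function.NonDependent.Propositional using (_×-⇔_)
open import Data.Sum.Base using (_⊎_; inj₁; inj₂; [_,_]′)
open import Data.Sum.Properties using (inj₁-injective; inj₂-injective)
open import Data.Unit.Base using (tt)
open import Data.Vec.Base using (Vec; []; _∷_; _++_; lookup; map; tabulate; splitAt)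
open import Data.Vec.Properties
  using (lookup∘tabulate; tabulate∘lookup; tabulate-cong; tabulate-∘; lookup-++ˡ; lookup-++ʳ;
         lookup-map; map-++; ++-injective)
open import Function.Base using (_∘_; id; case_of_)
open import Function.Bundles using (Injection; Inverse; Equivalence; _⇔_; mk⇔)
import Function.Construct.Composition as Composition
open import Function.Construct.Composition using (_⇔-∘_)
open import Function.Construct.Identity using (⇔-id)
open import Function.Construct.Symmetry using (⇔-sym)
open import Function.Definitions using (Injective)
open import Relation.Binary.Bundles using (Setoid)
open import Relation.Binary.Core using (Rel)
open import Relation.Binary.Definitions using (Reflexive; _Respects_; tri<; tri≈; tri>)
open import Relation.Binary.PropositionalEquality as ≡
  using (_≡_; _≢_; refl; sym; trans; cong; cong₂; subst; setoid; _→-setoid_; module ≡-Reasoning)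
open import Relation.Nullary.Decidable.Core
  using (Dec; yes; no; isYes; toWitness; fromWitness; decidable-stable)
open import Relation.Nullary.Negation using (¬_; contradiction)
open import Relation.Unary using (Pred; _∈_; _∉_; _⊆_; _≐_; _∩_; ∁)
open import Relation.Unary.Properties using (≐-refl)

open Equivalence using (to; from)

private
  variable
    ℓ : Level
    k m n p N : ℕ

-- Maximal cliques and embeddings of infinite sets

module Classical (em : ∀ a → ExcludedMiddle a) (ext : ∀ a b → Extensionality a b) where
  private
    variable
      a b c s : Level

  dec : (P : Set a) → Dec P
  dec P = em _

  stable : {P : Set a} → ¬ ¬ P → P
  stable {P = P} = decidable-stable (dec P)

  ¬∀⇒∃¬ : {A : Set a} {P : A → Set b} → ¬ (∀ x → P x) → ∃ λ x → ¬ P x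
  ¬∀⇒∃¬ f = stable λ g → f λ x → stable λ h → g (x , h)

  private
    T-antisym : ∀ {x y} → (T x → T y) → (T y → T x) → x ≡ y
    T-antisym {false} {false} f g = refl
    T-antisym {false} {true}  f g = ⊥-elim (g tt)
    T-antisym {true}  {false} f g = ⊥-elim (f tt)
    T-antisym {true}  {true}  f g = refl

  char : Set a → Bool
  char P = isYes (dec P)

  char-cong : {P : Set a} {Q : Set b} → (P → Q) → (Q → P) → char P ≡ char Q
  char-cong {P = P} {Q} f g =
    T-antisym (fromWitness ∘ f ∘ toWitness) (fromWitness ∘ g ∘ toWitness)

  char-cong⁻ : {P : Set a} {Q : Set b} → char P ≡ char Q → P → Q
  char-cong⁻ eq p = toWitness (subst T eq (fromWitness p))

  -- Subsets of S are functions to Bool, so that a family of subsets has a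
  -- union on the same universe level.
  module MaximalClique {S : Set s} (_~_ : Rel S s)
                       (~-refl : Reflexive _~_) (~-sym : ∀ {x y} → x ~ y → y ~ x) where

    private
      𝒫 : Set s
      𝒫 = S → Bool

      infix 4 _ε_ _⊑_
      _ε_ : S → 𝒫 → Set
      x ε U = T (U x)

      _⊑_ : 𝒫 → 𝒫 → Set s
      U ⊑ V = ∀ x → x ε U → x ε V

      Addable : 𝒫 → S → Set s
      Addable U x = ¬ x ε U × (∀ y → y ε U → x ~ y)

      ⟪_⟫ : Pred S b → 𝒫
      ⟪ P ⟫ x = char (P x)

      -- The equation with `dec` pins down the one point that excluded middle happens to supply, so
      -- at most one point is added.
      next : 𝒫 → 𝒫
      next U = ⟪ (λ y → y ε U ⊎ (∃ λ (p : ∃ (Addable U)) → dec (∃ (Addable U)) ≡ yes p × proj₁ p ≡ y)) ⟫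

      ⋃ : (𝒫 → Bool) → 𝒫
      ⋃ F = ⟪ (λ x → ∃ λ U → T (F U) × x ε U) ⟫

      -- The tower of the Bourbaki-Witt argument; it starts from the union of the empty family.
      data 𝒯 : 𝒫 → Set s where
        step  : ∀ {U} → 𝒯 U → 𝒯 (next U)
        union : ∀ F → (∀ U → T (F U) → 𝒯 U) → 𝒯 (⋃ F)

      ⊑-trans : ∀ {U V W} → U ⊑ V → V ⊑ W → U ⊑ W
      ⊑-trans f g x = g x ∘ f x

      ⊑-next : ∀ U → U ⊑ next U
      ⊑-next U x = fromWitness ∘ inj₁

      ⊑-⋃ : ∀ F {U} → T (F U) → U ⊑ ⋃ F
      ⊑-⋃ F U∈F x x∈U = fromWitness (_ , U∈F , x∈U)

      ⋃-⊑ : ∀ F {V} → (∀ U → T (F U) → U ⊑ V) → ⋃ F ⊑ V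
      ⋃-⊑ F h x x∈ = let U , U∈F , x∈U = toWitness x∈ in h U U∈F x x∈U

      ⊑-antisym : ∀ {U V} → U ⊑ V → V ⊑ U → U ≡ V
      ⊑-antisym f g = ext _ _ λ x → T-antisym (f x) (g x)

      Extreme : 𝒫 → Set s
      Extreme U = ∀ {V} → 𝒯 V → V ⊑ U → next V ⊑ U ⊎ U ⊑ V

      -- Deciding `Q` first allows the alternative, given separately for each member, to be pulled
      -- out of the union.
      ⋃-alternative : ∀ F {U} {Q : Set s} → (∀ V → T (F V) → V ⊑ U ⊎ Q) → ⋃ F ⊑ U ⊎ Q
      ⋃-alternative F {U} {Q} h with dec Q
      ... | yes q = inj₂ q
      ... | no ¬q = inj₁ (⋃-⊑ F λ V V∈F → [ id , (λ q → contradiction q ¬q) ]′ (h V V∈F))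

      -- Induction on the tower: a step from `V ⊑ U` stays below `U` by extremeness, unless `V`
      -- equals `U`, and then it is the step `next U`.
      extreme⇒comparable : ∀ {U V} → Extreme U → 𝒯 V → V ⊑ U ⊎ next U ⊑ V
      extreme⇒comparable {U} E (step {V} tV) with extreme⇒comparable E tV
      ... | inj₂ U⁺⊑V = inj₂ (⊑-trans U⁺⊑V (⊑-next V))
      ... | inj₁ V⊑U with E tV V⊑U
      ...   | inj₁ V⁺⊑U = inj₁ V⁺⊑U
      ...   | inj₂ U⊑V = inj₂ λ x → subst (λ W → x ε next W) (⊑-antisym U⊑V V⊑U)
      extreme⇒comparable E (union F tF) = ⋃-alternative F λ V V∈F →
        [ inj₁ , (λ U⁺⊑V → inj₂ (⊑-trans U⁺⊑V (⊑-⋃ F V∈F))) ]′ (extreme⇒comparable E (tF V V∈F))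

      𝒯⇒extreme : ∀ {U} → 𝒯 U → Extreme U
      𝒯⇒extreme (step {U} tU) tV V⊑U⁺ with extreme⇒comparable (𝒯⇒extreme tU) tV
      ... | inj₂ U⁺⊑V = inj₂ U⁺⊑V
      ... | inj₁ V⊑U with 𝒯⇒extreme tU tV V⊑U
      ...   | inj₁ V⁺⊑U = inj₁ (⊑-trans V⁺⊑U (⊑-next U))
      ...   | inj₂ U⊑V = inj₁ λ x → subst (λ W → x ε next W) (⊑-antisym V⊑U U⊑V)
      𝒯⇒extreme (union F tF) {V} tV V⊑⋃ = [ inj₂ , inj₁ ]′ (⋃-alternative F alternative)
        where
        alternative : ∀ U → T (F U) → U ⊑ V ⊎ next V ⊑ ⋃ F
        alternative U U∈F with extreme⇒comparable (𝒯⇒extreme (tF U U∈F)) tV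
        ... | inj₂ U⁺⊑V = inj₁ (⊑-trans (⊑-next U) U⁺⊑V)
        ... | inj₁ V⊑U with 𝒯⇒extreme (tF U U∈F) tV V⊑U
        ...   | inj₁ V⁺⊑U = inj₂ (⊑-trans V⁺⊑U (⊑-⋃ F U∈F))
        ...   | inj₂ U⊑V = inj₁ U⊑V

      chain : ∀ {U V} → 𝒯 U → 𝒯 V → U ⊑ V ⊎ V ⊑ U
      chain {U} tU tV with extreme⇒comparable (𝒯⇒extreme tU) tV
      ... | inj₁ V⊑U = inj₂ V⊑U
      ... | inj₂ U⁺⊑V = inj₁ (⊑-trans (⊑-next U) U⁺⊑V)

      Clique : 𝒫 → Set s
      Clique U = ∀ {x y} → x ε U → y ε U → x ~ y

      𝒯⇒clique : ∀ {U} → 𝒯 U → Clique U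
      𝒯⇒clique (step {U} tU) x∈ y∈ with toWitness x∈ | toWitness y∈
      ... | inj₁ x∈U | inj₁ y∈U = 𝒯⇒clique tU x∈U y∈U
      ... | inj₁ x∈U | inj₂ ((y , _ , y~U) , _ , refl) = ~-sym (y~U _ x∈U)
      ... | inj₂ ((x , _ , x~U) , _ , refl) | inj₁ y∈U = x~U _ y∈U
      -- Both are the point added at this step; the two equations with `dec` identify them.
      ... | inj₂ (p , eq , refl) | inj₂ (q , eq′ , refl) with trans (sym eq) eq′
      ...   | refl = ~-refl
      𝒯⇒clique (union F tF) x∈ y∈ with toWitness x∈ | toWitness y∈
      ... | U , U∈F , x∈U | V , V∈F , y∈V with chain (tF U U∈F) (tF V V∈F)
      ...   | inj₁ U⊑V = 𝒯⇒clique (tF V V∈F) (U⊑V _ x∈U) y∈V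
      ...   | inj₂ V⊑U = 𝒯⇒clique (tF U U∈F) x∈U (V⊑U _ y∈V)

      stages : 𝒫 → Bool
      stages U = char (𝒯 U)

      top : 𝒫
      top = ⋃ stages

      top∈𝒯 : 𝒯 top
      top∈𝒯 = union stages λ U → toWitness

      next-top : next top ⊑ top
      next-top = ⊑-⋃ stages (fromWitness (step top∈𝒯))

    M : Pred S _
    M x = x ε top

    M-clique : ∀ {x y} → x ∈ M → y ∈ M → x ~ y
    M-clique = 𝒯⇒clique top∈𝒯

    -- `top` includes every stage, in particular `next top`, so no point is left that could be
    -- added.
    M-maximal : ∀ x → (∀ y → y ∈ M → x ~ y) → x ∈ M
    M-maximal x x~M with dec (∃ (Addable top)) in eq
    ... | yes p = contradiction (next-top _ (fromWitness (inj₂ (p , eq , refl)))) (proj₁ (proj₂ p))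
    ... | no ¬p = stable λ x∉ → ¬p (x , x∉ , x~M)

  -- A clique is the graph of a partial injection. A maximal one is total or else onto, since an
  -- uncovered point of `P` could be paired with any point of `B` that is not hit.
  subset-comparable : {A : Set s} (P : Pred A s) (B : Set s) →
                      Injection (subsetSetoid P) (setoid B) ⊎ Injection (setoid B) (subsetSetoid P)
  subset-comparable {s = s} {A} P B = cases (dec (∀ x → x ∈ P → ∃ λ p → ∃ λ y → M ((x , p) , y)))
    where
    _~_ : Rel (Σ A P × B) s
    ((x , _) , y) ~ ((x′ , _) , y′) = (x ≡ x′ → y ≡ y′) × (y ≡ y′ → x ≡ x′)

    ~-sym : ∀ {p q} → p ~ q → q ~ p
    ~-sym (f , g) = (λ e → sym (f (sym e))) , (λ e → sym (g (sym e)))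

    open MaximalClique _~_ ((λ _ → refl) , (λ _ → refl)) (λ {p} {q} → ~-sym {p} {q})

    cases : Dec (∀ x → x ∈ P → ∃ λ p → ∃ λ y → M ((x , p) , y)) → _
    cases (yes total) = inj₁ record
      { to        = λ (x , p) → proj₁ (proj₂ (total x p))
      ; cong      = λ {(x , p)} {(x′ , p′)} →
          proj₁ (M-clique (proj₂ (proj₂ (total x p))) (proj₂ (proj₂ (total x′ p′))))
      ; injective = λ {(x , p)} {(x′ , p′)} →
          proj₂ (M-clique (proj₂ (proj₂ (total x p))) (proj₂ (proj₂ (total x′ p′))))
      }
    cases (no ¬total) with ¬∀⇒∃¬ ¬total
    ... | x , f with ¬∀⇒∃¬ f
    ...   | p , uncovered = inj₂ record
      { to        = λ y → proj₁ (onto y)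
      ; cong      = cong _
      ; injective = λ {y} {y′} → proj₁ (M-clique (proj₂ (onto y)) (proj₂ (onto y′)))
      }
      where
      onto : ∀ y → ∃ λ z → M (z , y)
      onto y = stable λ ¬∃ → uncovered (p , y , M-maximal _ λ
        { ((x′ , p′) , y′) m → (λ { refl → contradiction (p′ , y′ , m) uncovered })
                             , (λ { refl → contradiction ((x′ , p′) , m) ¬∃ }) })

  -- Hilbert hotels and decompositions of infinite sets

  private
    merge : ℕ ⊎ ℕ → ℕ
    merge (inj₁ n) = n + n
    merge (inj₂ n) = suc (n + n)

    double-injective : ∀ m n → m + m ≡ n + n → m ≡ n
    double-injective zero    zero    _ = refl
    double-injective (suc m) (suc n) e =
      cong suc (double-injective m n (suc-injective (trans (sym (+-suc m m)) (trans (suc-injective e) (+-suc n n)))))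

    even≢odd : ∀ m n → m + m ≢ suc (n + n)
    even≢odd (suc m) n       e = even≢odd n m (trans (sym (suc-injective e)) (+-suc m m))

    merge-injective : Injective _≡_ _≡_ merge
    merge-injective {inj₁ m} {inj₁ n} e = cong inj₁ (double-injective m n e)
    merge-injective {inj₁ m} {inj₂ n} e = contradiction e (even≢odd m n)
    merge-injective {inj₂ m} {inj₁ n} e = contradiction (sym e) (even≢odd n m)
    merge-injective {inj₂ m} {inj₂ n} e = cong inj₂ (double-injective m n (suc-injective e))

  -- Infinitude, in a form that yields fresh elements.
  Unlistable : {A : Set a} → Pred A b → Set _
  Unlistable P = ∀ xs → ∃ λ x → x ∈ P × x ∉ˡ xs

  listable : {A : Set a} {P : Pred A b} → ¬ Unlistable P → ∃ λ xs → ∀ {x} → x ∈ P → x ∈ˡ xs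
  listable ¬u = let xs , f = ¬∀⇒∃¬ ¬u in xs , λ p → stable λ x∉ → f (_ , p , x∉)

  module Sequence {A : Set a} {P : Pred A b} (unlistable : Unlistable P) (xs : List A) where
    private
      prefix : ℕ → List A
      prefix zero    = xs
      prefix (suc n) = proj₁ (unlistable (prefix n)) ∷ prefix n

    term : ℕ → A
    term n = proj₁ (unlistable (prefix n))

    term∈P : ∀ n → term n ∈ P
    term∈P n = proj₁ (proj₂ (unlistable (prefix n)))

    private
      fresh : ∀ n → term n ∉ˡ prefix n
      fresh n = proj₂ (proj₂ (unlistable (prefix n)))

      term∈prefix : ∀ {m n} → m < n → term m ∈ˡ prefix n
      term∈prefix {m} {suc n} (s≤s m≤n) with <-cmp m n
      ... | tri< m<n _ _ = there (term∈prefix m<n)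
      ... | tri≈ _ refl _ = here refl
      ... | tri> _ _ n<m = contradiction m≤n (<⇒≱ n<m)

    term∉xs : ∀ n → term n ∉ˡ xs
    term∉xs n x∈ = fresh n (weaken n x∈)
      where
      weaken : ∀ {x} n → x ∈ˡ xs → x ∈ˡ prefix n
      weaken zero    = λ x∈ → x∈
      weaken (suc n) = there ∘ weaken n

    term-injective : Injective _≡_ _≡_ term
    term-injective {m} {n} e with <-cmp m n
    ... | tri< m<n _ _ = contradiction (subst (_∈ˡ prefix n) e (term∈prefix m<n)) (fresh n)
    ... | tri≈ _ m≡n _ = m≡n
    ... | tri> _ _ n<m = contradiction (subst (_∈ˡ prefix m) (sym e) (term∈prefix n<m)) (fresh m)

  -- A Hilbert hotel: an occupant of address `j` moves to `target j`, everyone else stays. Targets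
  -- are themselves addressed places, so movers never collide with those who stay.
  module Reroute {A : Set a} {J : Set b} (At : J → A → Set c) (target : J → A)
                 (At-unique : ∀ {i j x y} → At i x → At j y → target i ≡ target j → x ≡ y)
                 (target-at : ∀ {i x} → At i x → ∃ λ j → At j (target i)) where
    reroute : A → A
    reroute x with dec (∃ λ j → At j x)
    ... | yes (j , _) = target j
    ... | no _        = x

    reroute-injective : Injective _≡_ _≡_ reroute
    reroute-injective {x} {y} e with dec (∃ λ j → At j x) | dec (∃ λ j → At j y)
    ... | yes (i , p) | yes (j , q) = At-unique p q e
    ... | yes (i , p) | no ¬q = contradiction (subst (λ z → ∃ λ j → At j z) e (target-at p)) ¬q
    ... | no ¬p | yes (j , q) = contradiction (subst (λ z → ∃ λ j → At j z) (sym e) (target-at q)) ¬p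
    ... | no ¬p | no ¬q = e

    reroute-elim : (Q : Pred A ℓ) → (∀ {j x} → At j x → Q (target j)) →
                   ∀ {x} → ((∀ j → ¬ At j x) → Q x) → Q (reroute x)
    reroute-elim Q f {x} g with dec (∃ λ j → At j x)
    ... | yes (j , p) = f p
    ... | no ¬p = g λ j p → ¬p (j , p)

  infix 4 _embedsIn_
  _embedsIn_ : (K : Set a) {A : Set b} → Pred A c → Set _
  K embedsIn P = ∃ λ (f : K → _) → Injective _≡_ _≡_ f × (∀ k → f k ∈ P)

  -- A sequence outside `xs` makes room: the entries of `xs` move to its even terms, and the
  -- sequence itself moves to its odd terms.
  avoid : {K : Set a} → Unlistable {A = K} (λ _ → K) → ∀ xs → K embedsIn (_∉ˡ xs)
  avoid {K = K} unlistable xs = reroute , reroute-injective ,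
      λ k → reroute-elim (_∉ˡ xs) (λ {j} _ → term∉xs (merge j))
              λ nowhere k∈ → nowhere (inj₁ (toℕ (index k∈))) (k∈ , refl)
    where
    open Sequence unlistable xs
    At : ℕ ⊎ ℕ → K → Set _
    At (inj₁ n) k = ∃ λ (k∈ : k ∈ˡ xs) → toℕ (index k∈) ≡ n
    At (inj₂ n) k = term n ≡ k

    At-functional : ∀ {j x y} → At j x → At j y → x ≡ y
    At-functional {inj₁ n} (x∈ , refl) (y∈ , e) =
      trans (lookup-index x∈) (trans (cong (List.lookup xs) (toℕ-injective (sym e))) (sym (lookup-index y∈)))
    At-functional {inj₂ n} refl refl = refl

    unique : ∀ {i j x y} → At i x → At j y → term (merge i) ≡ term (merge j) → x ≡ y
    unique {i} p q e = At-functional {i} p (subst (λ j → At j _) (sym (merge-injective (term-injective e))) q)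

    target-at : ∀ {i x} → At i x → ∃ λ j → At j (term (merge i))
    target-at {i} _ = inj₂ (merge i) , refl

    open Reroute At (term ∘ merge) (λ {i} {j} → unique {i} {j}) (λ {i} → target-at {i})

  -- Choose a maximal family of disjoint ladders, each consisting of an infinite
  -- sequence inside B and one outside.  What is left over is finite on one side
  -- of B, and each ladder can be moved into that half of it lying on the other side.
  infinite-indecomposable : {K : Set s} → Unlistable {A = K} (λ _ → K) → (B : Pred K s) →
                            K embedsIn B ⊎ K embedsIn ∁ B
  infinite-indecomposable {s = s} {K} unlistable B =
    conclude (dec (Unlistable (λ k → Leftover k × k ∈ B))) (dec (Unlistable (λ k → Leftover k × k ∉ B)))
    where
    Ladder : Set s
    Ladder = ∃ λ (w : ℕ ⊎ ℕ → K) →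
             Injective _≡_ _≡_ w × (∀ n → w (inj₁ n) ∈ B) × (∀ n → w (inj₂ n) ∉ B)

    rung : Ladder → ℕ ⊎ ℕ → K
    rung = proj₁

    _~_ : Rel Ladder s
    w ~ w′ = rung w ≡ rung w′ ⊎ (∀ i j → rung w i ≢ rung w′ j)

    ~-sym : ∀ {w w′} → w ~ w′ → w′ ~ w
    ~-sym (inj₁ e) = inj₁ (sym e)
    ~-sym (inj₂ d) = inj₂ λ i j e → d j i (sym e)

    open MaximalClique _~_ (inj₁ refl) (λ {w} {w′} → ~-sym {w} {w′})

    Leftover : Pred K s
    Leftover k = ∀ w → w ∈ M → ∀ i → rung w i ≢ k

    At : Ladder × (ℕ ⊎ ℕ) → K → Set s
    At (w , i) k = w ∈ M × rung w i ≡ k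

    module _ (side : ℕ → ℕ ⊎ ℕ) (side-injective : Injective _≡_ _≡_ side)
             (C : Pred K s) (side∈C : ∀ (w : Ladder) n → rung w (side n) ∈ C)
             (few : ∃ λ xs → ∀ {k} → Leftover k × k ∉ C → k ∈ˡ xs) where
      private
        target : Ladder × (ℕ ⊎ ℕ) → K
        target (w , i) = rung w (side (merge i))

        unique : ∀ {p q x y} → At p x → At q y → target p ≡ target q → x ≡ y
        unique {w , i} {w′ , j} (m , refl) (m′ , refl) e with M-clique m m′
        ... | inj₂ d = contradiction e (d _ _)
        ... | inj₁ w≡w′ = trans (cong (rung w) (merge-injective (side-injective
                (proj₁ (proj₂ w) (trans e (sym (cong (λ v → v (side (merge j))) w≡w′)))))))
              (cong (λ v → v j) w≡w′)

        target-at : ∀ {p x} → At p x → ∃ λ q → At q (target p)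
        target-at {w , i} (m , _) = (w , _) , m , refl

        open Reroute At target unique target-at

      moveInto : K embedsIn C
      -- Leftover points outside `C` are fixed by `reroute`; being finitely many, they are avoided
      -- beforehand.
      moveInto = let g , g-injective , g∉xs = avoid unlistable (proj₁ few) in
        reroute ∘ g , g-injective ∘ reroute-injective ,
        λ k → reroute-elim C (λ { {w , i} _ → side∈C w (merge i) })
          λ nowhere → stable λ ∉C →
            g∉xs k (proj₂ few ((λ w m i e → nowhere (w , i) (m , e)) , ∉C))

    conclude : Dec _ → Dec _ → _
    conclude (no fewB) _ = inj₂ (moveInto inj₂ inj₂-injective (∁ B) (λ (_ , _ , _ , w₂) → w₂)
      (let xs , h = listable fewB in xs , λ (l , ¬¬b) → h (l , stable ¬¬b)))
    conclude (yes _) (no few∁B) = inj₁ (moveInto inj₁ inj₁-injective B (λ (_ , _ , w₁ , _) → w₁) (listable few∁B))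
    -- Leftover sequences on both sides form a ladder disjoint from the whole family. By maximality
    -- it belongs to the family, so its rungs are not left over after all.
    conclude (yes manyB) (yes many∁B) = ⊥-elim (proj₁ (u∈ 0) ladder new∈M (inj₁ 0) refl)
      where
      open Sequence manyB [] renaming (term to u; term∈P to u∈; term-injective to u-injective)
      open Sequence many∁B [] renaming (term to v; term∈P to v∈; term-injective to v-injective)

      ladder : Ladder
      ladder = [ u , v ]′ ,
        (λ { {inj₁ _} {inj₁ _} e → cong inj₁ (u-injective e)
           ; {inj₂ _} {inj₂ _} e → cong inj₂ (v-injective e)
           ; {inj₁ m} {inj₂ n} e → contradiction (subst (_∈ B) e (proj₂ (u∈ m))) (proj₂ (v∈ n))
           ; {inj₂ m} {inj₁ n} e → contradiction (subst (_∈ B) (sym e) (proj₂ (u∈ n))) (proj₂ (v∈ m)) }) ,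
        (λ n → proj₂ (u∈ n)) , (λ n → proj₂ (v∈ n))

      new∈M : ladder ∈ M
      new∈M = M-maximal ladder λ w w∈M → inj₂ λ
        { (inj₁ n) j e → proj₁ (u∈ n) w w∈M j (sym e)
        ; (inj₂ n) j e → proj₁ (v∈ n) w w∈M j (sym e) }

  -- Induction on the number of pieces: `K` embeds into the preimage of the first piece or into the
  -- complement of that preimage.
  finite-union-embedding : {K : Set s} → Unlistable {A = K} (λ _ → K) → {A : Set a} →
    ∀ {n} (P : Fin n → Pred A s) → K embedsIn (λ x → ∃ λ i → x ∈ P i) → ∃ λ i → K embedsIn (P i)
  finite-union-embedding unlistable {n = zero} P (f , _ , f∈) =
    case proj₁ (f∈ (proj₁ (unlistable []))) of λ ()
  finite-union-embedding unlistable {n = suc n} P (f , f-inj , f∈)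
    with infinite-indecomposable unlistable (λ k → f k ∈ P zero)
  ... | inj₁ (g , g-inj , g∈) = zero , f ∘ g , g-inj ∘ f-inj , g∈
  ... | inj₂ (g , g-inj , g∉) =
    let i , e = finite-union-embedding unlistable (P ∘ suc) (f ∘ g , g-inj ∘ f-inj , λ k → later k (f∈ (g k)))
    in suc i , e
    where
    later : ∀ k → (∃ λ i → f (g k) ∈ P i) → ∃ λ i → f (g k) ∈ P (suc i)
    later k (zero  , p) = contradiction p (g∉ k)
    later k (suc i , p) = i , p

  ℕ-embedding⇒unlistable : {K : Set a} (f : ℕ → K) → Injective _≡_ _≡_ f → Unlistable {A = K} (λ _ → K)
  ℕ-embedding⇒unlistable f f-inj xs = stable λ ¬∃ →
    let all∈ : ∀ n → f n ∈ˡ xs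
        all∈ n = stable λ f∉ → ¬∃ (f n , f n , f∉)
        i , j , i<j , e = pigeonhole (n<1+n (length xs)) (λ i → index (all∈ (toℕ i)))
        fi≡fj = trans (lookup-index (all∈ (toℕ i))) (trans (cong (List.lookup xs) e)
                  (sym (lookup-index (all∈ (toℕ j)))))
    in <-irrefl (f-inj fi≡fj) i<j

  -- Canonical representatives of equivalence classes

  module _ {c ℓ} (S : Setoid c ℓ) where
    open Setoid S renaming (refl to ≈-refl; sym to ≈-sym; trans to ≈-trans)

    private
      class : Carrier → Carrier → Bool
      class x y = char (x ≈ y)

      -- Excluded middle acts as a choice function: the chosen point depends on `p` alone, the
      -- default `x` occurring only for empty `p`. Equivalent points have equal class functions by
      -- extensionality, hence the same choice.
      member : (p : Carrier → Bool) → Carrier → Carrier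
      member p x with dec (∃ λ y → T (p y))
      ... | yes (y , _) = y
      ... | no _        = x

      member-spec : ∀ x y → member (class x) y ≡ member (class x) x × x ≈ member (class x) x
      member-spec x y with dec (∃ λ y → T (class x y))
      ... | yes (y , p) = refl , toWitness p
      ... | no ¬∃ = contradiction (x , fromWitness ≈-refl) ¬∃

    representative : Carrier → Carrier
    representative x = member (class x) x

    representative-≈ : ∀ x → x ≈ representative x
    representative-≈ x = proj₂ (member-spec x x)

    representative-cong : ∀ {x y} → x ≈ y → representative x ≡ representative y
    representative-cong {x} {y} x≈y =
      trans (sym (proj₁ (member-spec x y)))
            (cong (λ p → member p y) (ext _ _ λ z → char-cong (≈-trans (≈-sym x≈y)) (≈-trans x≈y)))

-- Formulas and definable sets

¬-⇔ : ∀ {a b} {P : Set a} {Q : Set b} → P ⇔ Q → (¬ P) ⇔ (¬ Q)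
¬-⇔ e = mk⇔ (λ ¬p → ¬p ∘ from e) (λ ¬q → ¬q ∘ to e)

∃-⇔ : ∀ {a b c} {A : Set a} {P : A → Set b} {Q : A → Set c} → (∀ x → P x ⇔ Q x) → ∃ P ⇔ ∃ Q
∃-⇔ e = mk⇔ (λ (x , p) → x , to (e x) p) (λ (x , q) → x , from (e x) q)

≡⇒⇔ : ∀ {a} {P Q : Set a} → P ≡ Q → P ⇔ Q
≡⇒⇔ refl = ⇔-id _

infixr 5 _⊕_
_⊕_ : (Fin m → Fin p) → (Fin n → Fin p) → Fin (m + n) → Fin p
_⊕_ {m = m} f g i = [ f , g ]′ (Fin.splitAt m i)

module _ {a} {A : Set a} where
  reindex : (Fin m → Fin n) → Vec A n → Vec A m
  reindex f xs = tabulate (lookup xs ∘ f)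

  tabulate-++ : ∀ m {n} (f : Fin (m + n) → A) →
                tabulate f ≡ tabulate (f ∘ (_↑ˡ n)) ++ tabulate (f ∘ (m ↑ʳ_))
  tabulate-++ zero    f = refl
  tabulate-++ (suc m) f = cong (f zero ∷_) (tabulate-++ m (f ∘ suc))

  reindex-∘ : (f : Fin m → Fin n) (g : Fin n → Fin p) (xs : Vec A p) →
              reindex (g ∘ f) xs ≡ reindex f (reindex g xs)
  reindex-∘ f g xs = tabulate-cong λ i → sym (lookup∘tabulate (lookup xs ∘ g) (f i))

  reindex-↑ˡ : ∀ (xs : Vec A m) (ys : Vec A n) → reindex (_↑ˡ n) (xs ++ ys) ≡ xs
  reindex-↑ˡ xs ys = trans (tabulate-cong (lookup-++ˡ xs ys)) (tabulate∘lookup xs)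

  reindex-↑ʳ : ∀ (xs : Vec A m) (ys : Vec A n) → reindex (m ↑ʳ_) (xs ++ ys) ≡ ys
  reindex-↑ʳ xs ys = trans (tabulate-cong (lookup-++ʳ xs ys)) (tabulate∘lookup ys)

  reindex-⊕ : (f : Fin m → Fin p) (g : Fin n → Fin p) (xs : Vec A p) →
              reindex (f ⊕ g) xs ≡ reindex f xs ++ reindex g xs
  reindex-⊕ {m = m} {n = n} f g xs = trans (tabulate-++ m (lookup xs ∘ (f ⊕ g))) (cong₂ _++_
    (tabulate-cong λ i → cong (lookup xs ∘ [ f , g ]′) (splitAt-↑ˡ m i n))
    (tabulate-cong λ i → cong (lookup xs ∘ [ f , g ]′) (splitAt-↑ʳ m n i)))

module Renaming {L : Language ℓ} (𝔐 : Structure L) where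
  open Semantics 𝔐

  mutual
    renT : (Fin m → Fin n) → Term m → Term n
    renT f (var i)    = var (f i)
    renT f (app g ts) = app g (renTs f ts)

    renTs : (Fin m → Fin n) → Vec (Term m) k → Vec (Term n) k
    renTs f []       = []
    renTs f (t ∷ ts) = renT f t ∷ renTs f ts

  ren : (Fin m → Fin n) → Formula m → Formula n
  ren f (eq s t)   = eq (renT f s) (renT f t)
  ren f (pre R ts) = pre R (renTs f ts)
  ren f (neg φ)    = neg (ren f φ)
  ren f (and φ ψ)  = and (ren f φ) (ren f ψ)
  ren f (ex φ)     = ex (ren (Fin.lift 1 f) φ)

  mutual
    eval-ren : ∀ (f : Fin m → Fin n) ρ t → eval ρ (renT f t) ≡ eval (reindex f ρ) t
    eval-ren f ρ (var i)    = sym (lookup∘tabulate (lookup ρ ∘ f) i)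
    eval-ren f ρ (app g ts) = cong (funᴵ g) (evals-ren f ρ ts)

    evals-ren : ∀ (f : Fin m → Fin n) ρ (ts : Vec (Term m) k) → evals ρ (renTs f ts) ≡ evals (reindex f ρ) ts
    evals-ren f ρ []       = refl
    evals-ren f ρ (t ∷ ts) = cong₂ _∷_ (eval-ren f ρ t) (evals-ren f ρ ts)

  ⊨-ren : ∀ (f : Fin m → Fin n) {ρ} φ → (ρ ⊨ ren f φ) ⇔ (reindex f ρ ⊨ φ)
  ⊨-ren f {ρ} (eq s t)   = ≡⇒⇔ (cong₂ _≡_ (eval-ren f ρ s) (eval-ren f ρ t))
  ⊨-ren f {ρ} (pre R ts) = ≡⇒⇔ (cong (preᴵ R) (evals-ren f ρ ts))
  ⊨-ren f (neg φ)    = ¬-⇔ (⊨-ren f φ)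
  ⊨-ren f (and φ ψ)  = ⊨-ren f φ ×-⇔ ⊨-ren f ψ
  ⊨-ren f (ex φ)     = ∃-⇔ λ x → ⊨-ren (Fin.lift 1 f) φ

  ⊨-ren-≡ : ∀ (f : Fin m → Fin n) ρ {σ} φ → reindex f ρ ≡ σ → (ρ ⊨ ren f φ) ⇔ (σ ⊨ φ)
  ⊨-ren-≡ f ρ φ refl = ⊨-ren f φ

  exs : ∀ k → Formula (k + n) → Formula n
  exs zero    φ = φ
  exs (suc k) φ = exs k (ex φ)

  ⊨-exs : ∀ k {ρ : Vec Dom n} φ → (ρ ⊨ exs k φ) ⇔ (∃ λ (xs : Vec Dom k) → xs ++ ρ ⊨ φ)
  ⊨-exs zero    φ = mk⇔ (λ h → [] , h) (λ { ([] , h) → h })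
  ⊨-exs (suc k) φ = mk⇔ (λ (xs , x , h) → x ∷ xs , h) (λ { (x ∷ xs , h) → xs , x , h }) ⇔-∘ ⊨-exs k (ex φ)

  module _ (σ : Automorphism) where
    open Automorphism σ using (bijection; fun-preserved; pre-preserved) renaming (to to σ⟨_⟩; from to σ⁻¹⟨_⟩)

    mutual
      eval-map : (ρ : Vec Dom n) (t : Term n) → eval (map σ⟨_⟩ ρ) t ≡ σ⟨ eval ρ t ⟩
      eval-map ρ (var i)    = lookup-map i σ⟨_⟩ ρ
      eval-map ρ (app f ts) = trans (cong (funᴵ f) (evals-map ρ ts)) (sym (fun-preserved f (evals ρ ts)))

      evals-map : (ρ : Vec Dom n) (ts : Vec (Term n) k) → evals (map σ⟨_⟩ ρ) ts ≡ map σ⟨_⟩ (evals ρ ts)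
      evals-map ρ []       = refl
      evals-map ρ (t ∷ ts) = cong₂ _∷_ (eval-map ρ t) (evals-map ρ ts)

    ⊨-map : {ρ : Vec Dom n} (φ : Formula n) → (ρ ⊨ φ) ⇔ (map σ⟨_⟩ ρ ⊨ φ)
    ⊨-map {ρ = ρ} (eq s t) rewrite eval-map ρ s | eval-map ρ t =
      mk⇔ (cong σ⟨_⟩) λ e → trans (sym (Inverse.strictlyInverseʳ bijection _))
        (trans (cong σ⁻¹⟨_⟩ e) (Inverse.strictlyInverseʳ bijection _))
    ⊨-map {ρ = ρ} (pre R ts) rewrite evals-map ρ ts = pre-preserved R (evals ρ ts)
    ⊨-map (neg φ)   = ¬-⇔ (⊨-map φ)
    ⊨-map (and φ ψ) = ⊨-map φ ×-⇔ ⊨-map ψ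
    ⊨-map {ρ = ρ} (ex φ) = mk⇔
      (λ (x , h) → σ⟨ x ⟩ , to (⊨-map φ) h)
      (λ (y , h) → σ⁻¹⟨ y ⟩ , from (⊨-map φ)
        (subst (λ z → z ∷ map σ⟨_⟩ ρ ⊨ φ) (sym (Inverse.strictlyInverseˡ bijection y)) h))

  -- A pair (φ , i) is coded by a formula; starting from a conjunction makes
  -- the number of negations unambiguous.
  code₁ : Formula n → ℕ → Formula n
  code₁ φ zero    = and φ φ
  code₁ φ (suc i) = neg (code₁ φ i)

  code : Formula n → ℕ → ℕ → Formula n
  code φ i j = and (code₁ φ i) (code₁ φ j)

  code₁-injective : ∀ {φ ψ : Formula n} {i j} → code₁ φ i ≡ code₁ ψ j → φ ≡ ψ × i ≡ j
  code₁-injective {i = zero}  {zero}  refl = refl , refl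
  code₁-injective {i = suc i} {suc j} e =
    let φ≡ψ , i≡j = code₁-injective (neg-injective e) in φ≡ψ , cong suc i≡j
    where
    neg-injective : ∀ {φ ψ : Formula n} → neg φ ≡ neg ψ → φ ≡ ψ
    neg-injective refl = refl

  code-injective : ∀ {φ ψ : Formula n} {i i′ j j′} → code φ i j ≡ code ψ i′ j′ → φ ≡ ψ × i ≡ i′ × j ≡ j′
  code-injective {φ = φ} {ψ} {i} {i′} {j} {j′} e =
    let φ≡ψ , i≡i′ = code₁-injective (and-injectiveˡ e) in φ≡ψ , i≡i′ , proj₂ (code₁-injective (and-injectiveʳ e))
    where
    and-injectiveˡ : ∀ {φ φ′ ψ ψ′ : Formula n} → and φ ψ ≡ and φ′ ψ′ → φ ≡ φ′
    and-injectiveˡ refl = refl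
    and-injectiveʳ : ∀ {φ φ′ ψ ψ′ : Formula n} → and φ ψ ≡ and φ′ ψ′ → ψ ≡ ψ′
    and-injectiveʳ refl = refl

-- Definability of the group operations

module GroupFormulas {ℓ} {L : Language ℓ} {𝔐 : Structure L} (G : DefinableGroup 𝔐) where
  open Semantics 𝔐
  open Renaming 𝔐
  open DefinableGroupTheory G
  open Group group public
    using (∙-cong; ∙-congˡ; ∙-congʳ; ⁻¹-cong; assoc; identityˡ; identityʳ; inverseˡ; inverseʳ)
  open GroupProperties group public

  ⟦_⟧ : Formula dim → Subset
  ⟦ φ ⟧ x = proj₁ x ⊨ φ

  ⟦⟧-resp : ∀ φ → ⟦ φ ⟧ Respects _≈_
  ⟦⟧-resp φ = ≡.subst (_⊨ φ)

  exG : Formula (dim + n) → Formula n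
  exG {n} φ = exs dim (and (ren (_↑ˡ n) carrier) φ)

  ⊨-exG : ∀ (ρ : Vec Dom n) φ → (ρ ⊨ exG φ) ⇔ (∃ λ (x : Elem) → proj₁ x ++ ρ ⊨ φ)
  ⊨-exG {n} ρ φ = mk⇔
    (λ (xs , c , h) → (xs , to (⊨-ren-≡ (_↑ˡ n) (xs ++ ρ) carrier (reindex-↑ˡ xs ρ)) c) , h)
    (λ ((xs , c) , h) → xs , from (⊨-ren-≡ (_↑ˡ n) (xs ++ ρ) carrier (reindex-↑ˡ xs ρ)) c , h)
    ⇔-∘ ⊨-exs dim (and (ren (_↑ˡ n) carrier) φ)

  ⊨-exG² : ∀ (ρ : Vec Dom n) φ →
           (ρ ⊨ exG (exG φ)) ⇔ (∃ λ (y : Elem) → ∃ λ (x : Elem) → proj₁ x ++ (proj₁ y ++ ρ) ⊨ φ)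
  ⊨-exG² ρ φ = ∃-⇔ (λ y → ⊨-exG (proj₁ y ++ ρ) φ) ⇔-∘ ⊨-exG ρ (exG φ)

  graphAt : (f g h : Fin dim → Fin N) → Formula N
  graphAt f g h = ren (f ⊕ (g ⊕ h)) graph

  ⊨-graphAt : ∀ (f g h : Fin dim → Fin N) ρ x y z →
    reindex f ρ ≡ proj₁ x → reindex g ρ ≡ proj₁ y → reindex h ρ ≡ proj₁ z →
    (ρ ⊨ graphAt f g h) ⇔ (x ∙ y ≈ z)
  ⊨-graphAt f g h ρ x y z p q r = ⇔-sym (graph-∙ x y z) ⇔-∘ ⊨-ren-≡ (f ⊕ (g ⊕ h)) ρ graph
    (≡.trans (reindex-⊕ f (g ⊕ h) ρ) (≡.cong₂ _++_ p (≡.trans (reindex-⊕ g h ρ) (≡.cong₂ _++_ q r))))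

  block₀ : Fin dim → Fin (dim + n)
  block₀ {n} = _↑ˡ n

  block₁ : Fin dim → Fin (dim + (dim + n))
  block₁ = (dim ↑ʳ_) ∘ block₀

  block₂ : Fin dim → Fin (dim + (dim + dim))
  block₂ = (dim ↑ʳ_) ∘ (dim ↑ʳ_)

  module _ (x y : Vec Dom dim) where
    reindex-block₀ : (ρ : Vec Dom n) → reindex block₀ (x ++ ρ) ≡ x
    reindex-block₀ = reindex-↑ˡ x

    reindex-block₁ : (ρ : Vec Dom n) → reindex block₁ (x ++ (y ++ ρ)) ≡ y
    reindex-block₁ ρ = ≡.trans (reindex-∘ block₀ (dim ↑ʳ_) (x ++ (y ++ ρ)))
      (≡.trans (≡.cong (reindex block₀) (reindex-↑ʳ x (y ++ ρ))) (reindex-↑ˡ y ρ))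

    reindex-block₂ : (z : Vec Dom dim) → reindex block₂ (x ++ (y ++ z)) ≡ z
    reindex-block₂ z = ≡.trans (reindex-∘ (dim ↑ʳ_) (dim ↑ʳ_) (x ++ (y ++ z)))
      (≡.trans (≡.cong (reindex (dim ↑ʳ_)) (reindex-↑ʳ x (y ++ z))) (reindex-↑ʳ y z))

  -- The formula says `x ∙ x ≈ x`, which in a group only the identity satisfies.
  unitᶠ : Formula dim
  unitᶠ = graphAt id id id

  ⊨-unitᶠ : ∀ x → (x ∈ ⟦ unitᶠ ⟧) ⇔ (x ≈ ε)
  ⊨-unitᶠ x = mk⇔ (identityˡ-unique x x) (λ x≈ε → ≡.trans (∙-congʳ {x} {x} {ε} x≈ε) (identityˡ x))
    ⇔-∘ ⊨-graphAt id id id (proj₁ x) x x x (tab x) (tab x) (tab x)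
    where
    tab : ∀ x → reindex id (proj₁ x) ≡ proj₁ x
    tab x = tabulate∘lookup (proj₁ x)

  private
    mul-matrix : Formula dim → Formula dim → Formula (dim + (dim + dim))
    mul-matrix φ ψ = and (ren block₀ φ) (and (ren block₁ ψ) graph)

    div-matrix : Formula dim → Formula (dim + (dim + dim))
    div-matrix θ = and (ren block₀ θ) (graphAt block₁ block₀ block₂)

    inv-matrix : Formula dim → Formula (dim + (dim + dim))
    inv-matrix φ = and (ren block₀ φ) (and (graphAt block₀ block₂ block₁) (ren block₁ unitᶠ))

  mulᶠ : Formula dim → Formula dim → Formula dim
  mulᶠ φ ψ = exG (exG (mul-matrix φ ψ))

  ⊨-mulᶠ : ∀ φ ψ z → (z ∈ ⟦ mulᶠ φ ψ ⟧) ⇔ (z ∈ ⟦ φ ⟧ · ⟦ ψ ⟧)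
  ⊨-mulᶠ φ ψ z = mk⇔
    (λ h → let y , x , x∈φ , y∈ψ , e = to (⊨-exG² (proj₁ z) (mul-matrix φ ψ)) h
           in x , y , to (at₀ x y) x∈φ , to (at₁ x y) y∈ψ , ≡.sym (from (graph-∙ x y z) e))
    (λ (x , y , x∈φ , y∈ψ , e) → from (⊨-exG² (proj₁ z) (mul-matrix φ ψ))
      (y , x , from (at₀ x y) x∈φ , from (at₁ x y) y∈ψ , to (graph-∙ x y z) (≡.sym e)))
    where
    module _ (x y : Elem) where
      at₀ = ⊨-ren-≡ block₀ (proj₁ x ++ (proj₁ y ++ proj₁ z)) φ (reindex-block₀ (proj₁ x) (proj₁ y) (proj₁ y ++ proj₁ z))
      at₁ = ⊨-ren-≡ block₁ (proj₁ x ++ (proj₁ y ++ proj₁ z)) ψ (reindex-block₁ (proj₁ x) (proj₁ y) (proj₁ z))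

  powᶠ : Formula dim → ℕ → Formula dim
  powᶠ φ zero    = unitᶠ
  powᶠ φ (suc n) = mulᶠ φ (powᶠ φ n)

  ⊨-powᶠ : ∀ φ n z → (z ∈ ⟦ powᶠ φ n ⟧) ⇔ (z ∈ ⟦ φ ⟧ ^ n)
  ⊨-powᶠ φ zero    z = ⊨-unitᶠ z
  ⊨-powᶠ φ (suc n) z =
    ∃-⇔ (λ x → ∃-⇔ λ y → mk⇔ (λ (p , q , e) → p , to (⊨-powᶠ φ n y) q , e)
                             (λ (p , q , e) → p , from (⊨-powᶠ φ n y) q , e))
    ⇔-∘ ⊨-mulᶠ φ (powᶠ φ n) z

  -- The quotient is the solution `z` of `x ∙ z ≈ y`, an equation that `graph` can express.
  divᶠ : Formula dim → Formula (dim + dim)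
  divᶠ θ = exG (div-matrix θ)

  ⊨-divᶠ : ∀ θ x y → (proj₁ x ++ proj₁ y ⊨ divᶠ θ) ⇔ (x ⁻¹ ∙ y ∈ ⟦ θ ⟧)
  ⊨-divᶠ θ x y = mk⇔
    (λ h → let z , z∈θ , e = to (⊨-exG (proj₁ x ++ proj₁ y) (div-matrix θ)) h in
       ⟦⟧-resp θ {z} {x ⁻¹ ∙ y}
         (≡.trans (≡.sym (\\-leftDividesʳ x z)) (∙-congˡ {x ⁻¹} {x ∙ z} {y} (to (at-graph z) e)))
         (to (at₀ z) z∈θ))
    (λ h → from (⊨-exG (proj₁ x ++ proj₁ y) (div-matrix θ))
      (x ⁻¹ ∙ y , from (at₀ (x ⁻¹ ∙ y)) h , from (at-graph (x ⁻¹ ∙ y)) (\\-leftDividesˡ x y)))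
    where
    module _ (z : Elem) where
      at₀ = ⊨-ren-≡ block₀ (proj₁ z ++ (proj₁ x ++ proj₁ y)) θ (reindex-block₀ (proj₁ z) (proj₁ x) (proj₁ x ++ proj₁ y))
      at-graph = ⊨-graphAt block₁ block₀ block₂ (proj₁ z ++ (proj₁ x ++ proj₁ y)) x z y
        (reindex-block₁ (proj₁ z) (proj₁ x) (proj₁ y))
        (reindex-block₀ (proj₁ z) (proj₁ x) (proj₁ x ++ proj₁ y))
        (reindex-block₂ (proj₁ z) (proj₁ x) (proj₁ y))

  -- The inverse of `z` is an `x` for which `x ∙ z` is some `y` satisfying `unitᶠ`.
  invᶠ : Formula dim → Formula dim
  invᶠ φ = exG (exG (inv-matrix φ))

  ⊨-invᶠ : ∀ φ z → (z ∈ ⟦ invᶠ φ ⟧) ⇔ (z ⁻¹ ∈ ⟦ φ ⟧)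
  ⊨-invᶠ φ z = mk⇔
    (λ h → let y , x , x∈φ , e , u = to (⊨-exG² (proj₁ z) (inv-matrix φ)) h
           in ⟦⟧-resp φ {x} {z ⁻¹}
                (inverseˡ-unique x z (≡.trans (to (at-graph x y) e) (to (⊨-unitᶠ y) (to (at₁ x y) u))))
                (to (at₀ x y) x∈φ))
    (λ h → from (⊨-exG² (proj₁ z) (inv-matrix φ))
      (ε , z ⁻¹ , from (at₀ (z ⁻¹) ε) h , from (at-graph (z ⁻¹) ε) (inverseˡ z) ,
       from (at₁ (z ⁻¹) ε) (from (⊨-unitᶠ ε) refl)))
    where
    module _ (x y : Elem) where
      at₀ = ⊨-ren-≡ block₀ (proj₁ x ++ (proj₁ y ++ proj₁ z)) φ (reindex-block₀ (proj₁ x) (proj₁ y) (proj₁ y ++ proj₁ z))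
      at₁ = ⊨-ren-≡ block₁ (proj₁ x ++ (proj₁ y ++ proj₁ z)) unitᶠ (reindex-block₁ (proj₁ x) (proj₁ y) (proj₁ z))
      at-graph = ⊨-graphAt block₀ block₂ block₁ (proj₁ x ++ (proj₁ y ++ proj₁ z)) x z y
        (reindex-block₀ (proj₁ x) (proj₁ y) (proj₁ y ++ proj₁ z))
        (reindex-block₂ (proj₁ x) (proj₁ y) (proj₁ z))
        (reindex-block₁ (proj₁ x) (proj₁ y) (proj₁ z))

  Definable-resp : ∀ {D} → Definable D → D Respects _≈_
  Definable-resp (φ , D⇔φ) {x} {y} x≈y = from (D⇔φ y) ∘ ⟦⟧-resp φ {x} {y} x≈y ∘ to (D⇔φ x)

  TypeDefinable⇒Invariant : ∀ {D} → TypeDefinable D → Invariant D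
  TypeDefinable⇒Invariant (Γ , D⇔Γ) σ x y y≡σx x∈D = from (D⇔Γ y) λ φ φ∈Γ →
    ≡.subst (_⊨ φ) (≡.sym y≡σx) (to (⊨-map σ φ) (to (D⇔Γ x) x∈D φ φ∈Γ))

  ⟦⟧-invariant : ∀ φ → Invariant ⟦ φ ⟧
  ⟦⟧-invariant φ σ x y y≡σx = ≡.subst (_⊨ φ) (≡.sym y≡σx) ∘ to (⊨-map σ φ)

  module _ (σ : Automorphism) where
    private σ⟨_⟩ = Automorphism.to σ

    applyTo : Elem → Elem
    applyTo (x , x∈) = map σ⟨_⟩ x , to (⊨-map σ carrier) x∈

    -- Multiplication has a graph defined without parameters, which automorphisms of the structure
    -- preserve.
    applyTo-homo : ∀ x y → applyTo (x ∙ y) ≈ applyTo x ∙ applyTo y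
    applyTo-homo x y = ≡.sym (from (graph-∙ (applyTo x) (applyTo y) (applyTo (x ∙ y)))
      (≡.subst (_⊨ graph)
        (≡.trans (map-++ σ⟨_⟩ (proj₁ x) _) (≡.cong (map σ⟨_⟩ (proj₁ x) ++_) (map-++ σ⟨_⟩ (proj₁ y) _)))
        (to (⊨-map σ graph) (to (graph-∙ x y (x ∙ y)) refl))))

  module _ {Y : Subset} where
    ^-resp : ∀ n → (Y ^ n) Respects _≈_
    ^-resp zero    x≈y x≈ε = ≡.trans (≡.sym x≈y) x≈ε
    ^-resp (suc n) x≈y (a , b , a∈ , b∈ , e) = a , b , a∈ , b∈ , ≡.trans (≡.sym x≈y) e

    ⊆-^1 : Y ⊆ Y ^ 1
    ⊆-^1 {x} x∈ = x , ε , x∈ , refl , ≡.sym (identityʳ x)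

    ∙-^ : ∀ m n {x y} → x ∈ Y ^ m → y ∈ Y ^ n → x ∙ y ∈ Y ^ (m + n)
    ∙-^ zero    n {x} {y} x≈ε y∈ = ^-resp n {y} {x ∙ y} (≡.sym (≡.trans (∙-congʳ {y} {x} {ε} x≈ε) (identityˡ y))) y∈
    ∙-^ (suc m) n {x} {y} (a , b , a∈ , b∈ , e) y∈ =
      a , b ∙ y , a∈ , ∙-^ m n b∈ y∈ , ≡.trans (∙-congʳ {y} {x} {a ∙ b} e) (assoc a b y)

  ^-mono : ∀ {Y Z : Subset} n → Y ⊆ Z → Y ^ n ⊆ Z ^ n
  ^-mono zero    Y⊆Z e = e
  ^-mono (suc n) Y⊆Z (a , b , a∈ , b∈ , e) = a , b , Y⊆Z a∈ , ^-mono n Y⊆Z b∈ , e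

  ^⊆subgroup : ∀ {Y K : Subset} → IsSubgroup K → Y ⊆ K → ∀ n → Y ^ n ⊆ K
  ^⊆subgroup K≤ Y⊆K zero    {x} x≈ε = IsSubgroup.respects K≤ {ε} {x} (≡.sym x≈ε) (IsSubgroup.ε-closed K≤)
  ^⊆subgroup K≤ Y⊆K (suc n) {x} (a , b , a∈ , b∈ , e) = IsSubgroup.respects K≤ {a ∙ b} {x} (≡.sym e)
    (IsSubgroup.∙-closed K≤ (Y⊆K a∈) (^⊆subgroup K≤ Y⊆K n b∈))

  module _ {Y : Subset} (Y-resp : Y Respects _≈_) where
    symmetric⇒⁻¹-closed : Symmetric Y → ∀ {x} → x ∈ Y → x ⁻¹ ∈ Y
    symmetric⇒⁻¹-closed ((_ , Y⁻¹⊆Y) , _) {x} x∈ = Y⁻¹⊆Y (x , x∈ , refl)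

    ⁻¹-closed⇒symmetric : (∀ {x} → x ∈ Y → x ⁻¹ ∈ Y) → ε ∈ Y → Symmetric Y
    ⁻¹-closed⇒symmetric closed ε∈ =
      ((λ {x} x∈ → x ⁻¹ , closed x∈ , ≡.sym (⁻¹-involutive x)) ,
       (λ {z} (x , x∈ , e) → Y-resp {x ⁻¹} {z} (≡.sym e) (closed x∈))) , ε∈

  ^-⁻¹ : ∀ {Y : Subset} → (∀ {x} → x ∈ Y → x ⁻¹ ∈ Y) → ∀ n {x} → x ∈ Y ^ n → x ⁻¹ ∈ Y ^ n
  ^-⁻¹ closed zero    {x} x≈ε = ≡.trans (⁻¹-cong {x} {ε} x≈ε) ε⁻¹≈ε
  ^-⁻¹ {Y} closed (suc n) {x} (a , b , a∈ , b∈ , e) =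
    ≡.subst (λ k → x ⁻¹ ∈ Y ^ k) (+-comm n 1)
      (^-resp (n + 1) {b ⁻¹ ∙ a ⁻¹} {x ⁻¹}
        (≡.sym (≡.trans (⁻¹-cong {x} {a ∙ b} e) (⁻¹-anti-homo-∙ a b)))
        (∙-^ n 1 (^-⁻¹ closed n b∈) (⊆-^1 (closed a∈))))

-- Saturation and homogeneity

module Monster (em : ∀ a → ExcludedMiddle a) (ext : ∀ a b → Extensionality a b)
               {ℓ} {L : Language ℓ} (ℭ : Structure L) (κ : Set ℓ)
               (monster : Semantics.IsMonster ℭ κ) where
  open Classical em ext
  open Semantics ℭ
  open Renaming ℭ
  open IsMonster monster

  ,-injectiveʳ-K : ∀ {a b} {A : Set a} {B : A → Set b} {x : A} {y z : B x} →
                   _≡_ {A = Σ A B} (x , y) (x , z) → y ≡ z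
  ,-injectiveʳ-K refl = refl

  -- Iterated negation gives infinitely many formulas; their singletons embed `ℕ` into the power set
  -- of the formulas and so into `κ`.
  κ-unlistable : Unlistable {A = κ} (λ _ → κ)
  κ-unlistable = ℕ-embedding⇒unlistable (Injection.to (proj₁ large) ∘ indicator) λ {i} {j} e →
    proj₂ (code₁-injective (,-injectiveʳ-K
      (char-cong⁻ (Injection.injective (proj₁ large) e (1 , code₁ φ₀ i)) refl)))
    where
    φ₀ : Formula 1
    φ₀ = eq (var zero) (var zero)

    indicator : ℕ → ∃ Formula → Bool
    indicator i ψ = char (ψ ≡ (1 , code₁ φ₀ i))

  embeds-in-2^Formula⇒small : ∀ {c d} {S : Setoid c d} →
                              Injection S (∃ Formula →-setoid Bool) → S <ᶜ setoid κ
  embeds-in-2^Formula⇒small f =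
    Composition.injection f (proj₁ large) , λ g → proj₂ large (Composition.injection g f)

  Small : Pred Dom ℓ → Set ℓ
  Small A = subsetSetoid A <ᶜ setoid κ

  -- By comparability of cardinals, a union that is not small contains a copy of `κ`, and then so
  -- does one of the pieces.
  finite-union-small : ∀ {n} (P : Fin n → Pred Dom ℓ) → (∀ i → ¬ (κ embedsIn P i)) →
                       Small (λ x → ∃ λ i → x ∈ P i)
  finite-union-small P ¬emb with subset-comparable (λ x → ∃ λ i → x ∈ P i) κ
  ... | inj₁ f = f , refute
    where
    refute : ¬ Injection (setoid κ) (subsetSetoid (λ x → ∃ λ i → x ∈ P i))
    refute g =
      let open Injection g using () renaming (to to h; injective to h-injective)
          i , e = finite-union-embedding κ-unlistable P (proj₁ ∘ h , h-injective , proj₂ ∘ h)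
      in ¬emb i e
  ... | inj₂ g =
      let open Injection g using () renaming (to to h; injective to h-injective)
          i , e = finite-union-embedding κ-unlistable P (proj₁ ∘ h , h-injective , proj₂ ∘ h)
      in contradiction e (¬emb i)

  Entries : ∀ {n} → Vec Dom n → Pred Dom ℓ
  Entries u x = ∃ λ i → x ≡ lookup u i

  entries-small : ∀ {n} (u : Vec Dom n) → Small (Entries u)
  entries-small u = finite-union-small (λ i x → x ≡ lookup u i) λ i (f , f-injective , f≡) →
    let x , _ , _ = κ-unlistable []
        y , _ , y∉ = κ-unlistable (x ∷ [])
    in y∉ (here (f-injective (trans (f≡ y) (sym (f≡ x)))))

  entries : ∀ {n} (u : Vec Dom n) → Vec (Σ Dom (Entries u)) n
  entries u = tabulate λ i → lookup u i , i , refl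

  map-entries : ∀ {n} (u : Vec Dom n) → map proj₁ (entries u) ≡ u
  map-entries u = trans (sym (tabulate-∘ proj₁ _)) (tabulate∘lookup u)

  saturation : ∀ {A n} → Small A → {I : Set ℓ} (ψ : I → FormulaOver A n) →
               (∀ is → ∃ λ x → All (λ i → x ⊨ₚ ψ i) is) → ∃ λ x → ∀ i → x ⊨ₚ ψ i
  saturation {A} {n} A-small {I} ψ fin =
    let x , x⊨ = saturated A A-small (λ χ → ∃ λ i → χ ≡ ψ i) finSat
    in x , λ i → x⊨ (ψ i) (i , refl)
    where
    collect : ∀ {x φs} (ps : All (λ χ → ∃ λ i → χ ≡ ψ i) φs) →
              All (λ i → x ⊨ₚ ψ i) (All.reduce proj₁ ps) → All (x ⊨ₚ_) φs
    collect []               []       = []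
    collect ((i , refl) ∷ ps) (h ∷ hs) = h ∷ collect ps hs

    finSat : FinitelySatisfiable (λ χ → ∃ λ i → χ ≡ ψ i)
    finSat φs ps = let x , h = fin (All.reduce proj₁ ps) in x , collect ps h

  saturation-over-tuple : ∀ {n k} (u : Vec Dom k) {I : Set ℓ} (ψ : I → Formula (n + k)) →
    (∀ is → ∃ λ x → All (λ i → x ++ u ⊨ ψ i) is) → ∃ λ x → ∀ i → x ++ u ⊨ ψ i
  saturation-over-tuple {n} u ψ fin =
    let x , x⊨ = saturation (entries-small u) over λ is →
          let x , h = fin is in x , All.map (λ {i} → subst (λ v → x ++ v ⊨ ψ i) (sym (map-entries u))) h
    in x , λ i → subst (λ v → x ++ v ⊨ ψ i) (map-entries u) (x⊨ i)
    where
    over : _ → FormulaOver (Entries u) n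
    over i = record { formula = ψ i ; params = entries u }

  conjugate : ∀ {n} (u v : Vec Dom n) → (∀ φ → u ⊨ φ → v ⊨ φ) →
              ∃ λ (σ : Automorphism) → map (Automorphism.to σ) u ≡ v
  conjugate u v u→v =
    let σ , σ≡ = homogeneous (Entries u) (entries-small u) move elementary
    in σ , (begin
      map (Automorphism.to σ) u                         ≡⟨ cong (map _) (tabulate∘lookup u) ⟨
      map (Automorphism.to σ) (tabulate (lookup u))     ≡⟨ tabulate-∘ (Automorphism.to σ) (lookup u) ⟨
      tabulate (Automorphism.to σ ∘ lookup u)           ≡⟨ tabulate-cong (λ i → σ≡ (lookup u i , i , refl)) ⟩
      tabulate (lookup v)                               ≡⟨ tabulate∘lookup v ⟩
      v                                                 ∎)
    where
    open ≡-Reasoning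

    -- The position recorded in the membership proof selects the image, so repeated entries of `u`
    -- cause no trouble.
    move : Σ Dom (Entries u) → Dom
    move (_ , i , _) = lookup v i

    position : ∀ {k} → Vec (Σ Dom (Entries u)) k → Fin k → Fin _
    position as j = proj₁ (proj₂ (lookup as j))

    map-proj₁ : ∀ {k} (as : Vec (Σ Dom (Entries u)) k) → reindex (position as) u ≡ map proj₁ as
    map-proj₁ []                  = refl
    map-proj₁ ((_ , _ , e) ∷ as) = cong₂ _∷_ (sym e) (map-proj₁ as)

    map-move : ∀ {k} (as : Vec (Σ Dom (Entries u)) k) → reindex (position as) v ≡ map move as
    map-move []       = refl
    map-move (_ ∷ as) = cong (_ ∷_) (map-move as)

    transfer : ∀ {k} (φ : Formula k) as → map proj₁ as ⊨ φ → map move as ⊨ φ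
    transfer φ as h = to (⊨-ren-≡ (position as) v φ (map-move as))
      (u→v (ren (position as) φ) (from (⊨-ren-≡ (position as) u φ (map-proj₁ as)) h))

    elementary : Elementary (Entries u) move
    elementary φ as = mk⇔ (transfer φ as) λ h → stable λ ¬h → transfer (neg φ) as ¬h h

-- Generic symmetric sets and a subgroup of bounded index

module Approximate (em : ∀ a → ExcludedMiddle a) (ext : ∀ a b → Extensionality a b)
    {ℓ} {L : Language ℓ} (ℭ : Structure L) (κ : Set ℓ) (monster : Semantics.IsMonster ℭ κ)
    (G : DefinableGroup ℭ)
    (X : DefinableGroupTheory.Subset G) (X-definable : DefinableGroupTheory.Definable G X)
    (X-approximate : DefinableGroupTheory.ApproximateSubgroup G X) where
  open Classical em ext
  open Monster em ext ℭ κ monster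
  open Semantics ℭ
  open Renaming ℭ
  open DefinableGroupTheory G
  open GroupFormulas G

  H : Subset
  H = ⟨ X ⟩

  H-subgroup : IsSubgroup H
  H-subgroup = record { respects = resp ; ε-closed = unit ; ∙-closed = mul ; ⁻¹-closed = inv }

  X-resp : X Respects _≈_
  X-resp = Definable-resp X-definable

  ε∈X : ε ∈ X
  ε∈X = proj₂ (proj₁ X-approximate)

  X-⁻¹ : ∀ {x} → x ∈ X → x ⁻¹ ∈ X
  X-⁻¹ = symmetric⇒⁻¹-closed X-resp (proj₁ X-approximate)

  X^⊆H : ∀ n → X ^ n ⊆ H
  X^⊆H = ^⊆subgroup H-subgroup incl

  H⊆⋃X^ : ∀ {x} → x ∈ H → ∃ λ n → x ∈ X ^ n
  H⊆⋃X^ (incl x∈) = 1 , ⊆-^1 x∈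
  H⊆⋃X^ unit = 0 , refl
  H⊆⋃X^ (mul x∈ y∈) = let m , p = H⊆⋃X^ x∈ ; n , q = H⊆⋃X^ y∈ in m + n , ∙-^ m n p q
  H⊆⋃X^ (inv x∈) = let n , p = H⊆⋃X^ x∈ in n , ^-⁻¹ X-⁻¹ n p
  H⊆⋃X^ (resp {x} {y} x≈y x∈) = let n , p = H⊆⋃X^ x∈ in n , ^-resp n {x} {y} x≈y p

  CoveredBy-trans : ∀ {A B C : Subset} {gs hs} → CoveredBy A gs B → CoveredBy B hs C →
                    CoveredBy A (cartesianProductWith _∙_ gs hs) C
  CoveredBy-trans A⊆ B⊆ {z} z∈ =
    let g , g∈ , b , b∈ , z≈gb = find (A⊆ z∈)
        h , h∈ , c , c∈ , b≈hc = find (B⊆ b∈)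
    in lose (∈-cartesianProductWith⁺ _∙_ g∈ h∈)
         (c , c∈ , ≡.trans z≈gb (≡.trans (∙-congˡ {g} {b} {h ∙ c} b≈hc) (≡.sym (assoc g h c))))

  CoveredBy-· : ∀ {A B C : Subset} {gs} → CoveredBy A gs B → CoveredBy (A · C) gs (B · C)
  CoveredBy-· A⊆ {z} (a , c , a∈ , c∈ , z≈ac) =
    Any.map (λ {g} (b , b∈ , a≈gb) → b ∙ c , (b , c , b∈ , c∈ , refl) ,
      ≡.trans z≈ac (≡.trans (∙-congʳ {c} {a} {g ∙ b} a≈gb) (assoc g b c))) (A⊆ a∈)

  ^-suc⊆ : ∀ {Y : Subset} n → Y ^ suc n ⊆ (Y ^ n) · Y
  ^-suc⊆ zero (y , w , y∈ , w≈ε , e) =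
    ε , y , refl , y∈ , ≡.trans e (≡.trans (∙-congˡ {y} {w} {ε} w≈ε) (≡.trans (identityʳ y) (≡.sym (identityˡ y))))
  ^-suc⊆ (suc n) (y , w , y∈ , w∈ , e) =
    let a , b , a∈ , b∈ , w≈ab = ^-suc⊆ n {w} w∈
    in y ∙ a , b , (y , a , y∈ , a∈ , refl) , b∈ ,
       ≡.trans e (≡.trans (∙-congˡ {y} {w} {a ∙ b} w≈ab) (≡.sym (assoc y a b)))

  -- With the last factor split off, a cover of `X ^ n` by translates of `X` covers the next power
  -- by translates of `X · X`, and these by translates of `X`.
  X^-covered : ∀ n → ∃ λ gs → CoveredBy (X ^ n) gs X
  X^-covered zero    = ε ∷ [] , λ z≈ε → here (ε , ε∈X , ≡.trans z≈ε (≡.sym (identityˡ ε)))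
  X^-covered (suc n) =
    let gs , X^⊆ = X^-covered n
        hs , XX⊆ = proj₂ X-approximate
    in _ , λ {z} z∈ → CoveredBy-trans
         (λ {z} → CoveredBy-· (λ {z} → X^⊆ {z}) {z}) (λ {z} → XX⊆ {z}) {z} (^-suc⊆ n {z} z∈)

  χ : Formula dim
  χ = proj₁ X-definable

  X⇔χ : ∀ x → x ∈ X ⇔ x ∈ ⟦ χ ⟧
  X⇔χ = proj₂ X-definable

  -- The sets `Y` of conditions (2) and (3), given by formulas so that quantifying over them stays
  -- within `Set ℓ`.
  record Good (φ : Formula dim) : Set ℓ where
    field
      contained : ⟦ φ ⟧ ⊆ H
      generic   : Generic X ⟦ φ ⟧
      symmetric : Symmetric ⟦ φ ⟧

  module _ {φ} (good : Good φ) where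
    Good-⁻¹ : ∀ {x} → x ∈ ⟦ φ ⟧ → x ⁻¹ ∈ ⟦ φ ⟧
    Good-⁻¹ {x} = symmetric⇒⁻¹-closed (λ {x} {y} → ⟦⟧-resp φ {x} {y}) (Good.symmetric good) {x}

    Good-ε : ∀ n → ε ∈ ⟦ φ ⟧ ^ n
    Good-ε zero    = refl
    Good-ε (suc n) = ε , ε , proj₂ (Good.symmetric good) , Good-ε n , ≡.sym (identityˡ ε)

    Good-+ˡ : ∀ m n → ⟦ φ ⟧ ^ n ⊆ ⟦ φ ⟧ ^ (m + n)
    Good-+ˡ m n {x} x∈ = ^-resp (m + n) {ε ∙ x} {x} (identityˡ x) (∙-^ m n (Good-ε m) x∈)

    Good-+ʳ : ∀ m n → ⟦ φ ⟧ ^ m ⊆ ⟦ φ ⟧ ^ (m + n)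
    Good-+ʳ m n {x} x∈ = ^-resp (m + n) {x ∙ ε} {x} (identityʳ x) (∙-^ m n x∈ (Good-ε n))

    Good-covers : ∀ n → ∃ λ gs → CoveredBy (X ^ n) gs ⟦ φ ⟧
    Good-covers n = _ , λ {z} → CoveredBy-trans
      (λ {z} → proj₂ (X^-covered n) {z}) (λ {z} → Generic.covers (Good.generic good) {z}) {z}

  χ-good : Good χ
  χ-good = record
    { contained = λ {x} x∈ → incl (from (X⇔χ x) x∈)
    ; generic   = record
      { translates     = ε ∷ []
      ; translates⊆⟨X⟩ = unit ∷ []
      ; covers         = λ {x} x∈ → here (x , to (X⇔χ x) x∈ , ≡.sym (identityˡ x))
      }
    ; symmetric = ⁻¹-closed⇒symmetric (λ {x} {y} → ⟦⟧-resp χ {x} {y})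
        (λ {x} x∈ → to (X⇔χ (x ⁻¹)) (X-⁻¹ (from (X⇔χ x) x∈))) (to (X⇔χ ε) ε∈X)
    }

  U : Subset
  U x = ∃ λ n → ∀ φ → Good φ → x ∈ ⟦ φ ⟧ ^ n

  U-subgroup : IsSubgroup U
  U-subgroup = record
    { respects  = λ {x} {y} x≈y (n , h) → n , λ φ good → ^-resp n {x} {y} x≈y (h φ good)
    ; ε-closed  = 0 , λ _ _ → refl
    ; ∙-closed  = λ (m , p) (n , q) → m + n , λ φ good → ∙-^ m n (p φ good) (q φ good)
    ; ⁻¹-closed = λ (n , p) → n , λ φ good → ^-⁻¹ (λ {x} → Good-⁻¹ good {x}) n (p φ good)
    }

  U-invariant : Invariant U
  U-invariant σ x y y≡σx (n , h) = n , λ φ good →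
    to (⊨-powᶠ φ n y) (⟦⟧-invariant (powᶠ φ n) σ x y y≡σx (from (⊨-powᶠ φ n x) (h φ good)))

  private
    -- Deciding `Good φ` fixes one list for each `φ` and `n`, whatever proof of goodness is at hand,
    -- so that positions in it can be compared. The empty list is a default.
    cover : Formula dim → ℕ → List Elem
    cover φ n with dec (Good φ)
    ... | yes good = proj₁ (Good-covers good n)
    ... | no _     = []

    cover-covers : ∀ {φ} → Good φ → ∀ n → CoveredBy (X ^ n) (cover φ n) ⟦ φ ⟧
    cover-covers {φ} good n with dec (Good φ)
    ... | yes good′ = proj₂ (Good-covers good′ n)
    ... | no ¬good  = contradiction good ¬good

    -- Records in which translates of which sets `a` lies. Coding each record as a single formula
    -- makes the collection of addresses a subset of `∃ Formula`.
    Address : Elem → ∃ Formula → Set ℓ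
    Address a ψ = ∃ λ φ → ∃ λ n → ∃ λ i →
      a ∈ (List.lookup (cover φ n) i ⟨·⟩ ⟦ φ ⟧) × ψ ≡ (dim , code φ n (toℕ i))

    same-translate : ∀ {φ} → Good φ → ∀ {a b g} → a ∈ (g ⟨·⟩ ⟦ φ ⟧) → b ∈ (g ⟨·⟩ ⟦ φ ⟧) →
                     a ⁻¹ ∙ b ∈ ⟦ φ ⟧ ^ 2
    same-translate {φ} good {a} {b} {g} (x , x∈ , a≈gx) (y , y∈ , b≈gy) =
      ^-resp 2 {x ⁻¹ ∙ y} {a ⁻¹ ∙ b} (≡.sym a⁻¹b≈x⁻¹y)
        (∙-^ 1 1 (⊆-^1 {⟦ φ ⟧} {x ⁻¹} (Good-⁻¹ good {x} x∈)) (⊆-^1 {⟦ φ ⟧} {y} y∈))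
      where
      a⁻¹b≈x⁻¹y : a ⁻¹ ∙ b ≈ x ⁻¹ ∙ y
      a⁻¹b≈x⁻¹y = ≡.trans (∙-cong {a ⁻¹} {x ⁻¹ ∙ g ⁻¹} {b} {g ∙ y}
                     (≡.trans (⁻¹-cong {a} {g ∙ x} a≈gx) (⁻¹-anti-homo-∙ g x)) b≈gy)
             (≡.trans (assoc (x ⁻¹) (g ⁻¹) (g ∙ y)) (∙-congˡ {x ⁻¹} {g ⁻¹ ∙ (g ∙ y)} {y} (\\-leftDividesʳ g y)))

    -- Each good set has a translate containing both points, and the quotient of two points of one
    -- translate is a product of two elements of the set. So the exponent 2 serves all good sets.
    same-addresses : ∀ {a b} → a ∈ H → (∀ ψ → Address a ψ → Address b ψ) → a ⁻¹ ∙ b ∈ U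
    same-addresses {a} {b} a∈H a⇒b = 2 , λ φ good →
      let n , a∈X^n = H⊆⋃X^ a∈H
          a∈ = cover-covers good n a∈X^n
          i  = Any.index a∈
          a∈gφ = lookup-index a∈
          φ′ , n′ , j , b∈ , e = a⇒b (dim , code φ n (toℕ i)) (φ , n , i , a∈gφ , refl)
          φ≡φ′ , n≡n′ , i≡j = code-injective (,-injectiveʳ-K e)
      in decode good φ≡φ′ n≡n′ i≡j a∈gφ b∈
      where
      decode : ∀ {φ φ′ n n′ i j} → Good φ → φ ≡ φ′ → n ≡ n′ → toℕ i ≡ toℕ j →
               a ∈ (List.lookup (cover φ n) i ⟨·⟩ ⟦ φ ⟧) → b ∈ (List.lookup (cover φ′ n′) j ⟨·⟩ ⟦ φ′ ⟧) →
               a ⁻¹ ∙ b ∈ ⟦ φ ⟧ ^ 2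
      decode good refl refl i≡j a∈ b∈ with toℕ-injective i≡j
      ... | refl = same-translate good a∈ b∈

  U-bounded : BoundedIndexSubgroup κ H U
  U-bounded = record
    { isSubgroup = U-subgroup
    ; contained  = λ (n , h) → X^⊆H n (^-mono n (λ {x} → from (X⇔χ x)) (h χ χ-good))
    ; bounded    = embeds-in-2^Formula⇒small record
      -- Addresses can vary within a coset, so they are read off at its representative.
      { to        = λ x ψ → char (Address (proj₁ (rep x)) ψ)
      ; cong      = λ x~y ψ → ≡.cong (λ r → char (Address (proj₁ r) ψ)) (representative-cong H/U x~y)
      ; injective = λ {x} {y} same → Setoid.trans H/U {x} {rep x} {y} (representative-≈ H/U x)
          (Setoid.trans H/U {rep x} {rep y} {y}
            (same-addresses (proj₂ (rep x)) (λ ψ → char-cong⁻ (same ψ)))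
            (Setoid.sym H/U {y} {rep y} (representative-≈ H/U y)))
      }
    }
    where
    H/U = cosets H U-subgroup
    rep = representative H/U

  -- Piecewise syndetic sets

  -- As in topological dynamics: a set is thick in K when it contains a right
  -- translate of every finite subset of K, and big (piecewise syndetic) when
  -- finitely many of its translates have a thick union.
  module _ {K : Subset} (K-subgroup : IsSubgroup K) where
    open IsSubgroup K-subgroup

    Thick : Subset → Set ℓ
    Thick D = ∀ ss → All (_∈ K) ss → ∃ λ a → All (λ s → s ∙ a ∈ D) ss

    infixl 7 _✶_
    _✶_ : List Elem → Subset → Subset
    (fs ✶ D) z = Any (λ f → f ⁻¹ ∙ z ∈ D) fs

    Big : Subset → Set ℓ
    Big D = ∃ λ fs → All (_∈ K) fs × Thick (fs ✶ D)

    private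
      products : ∀ (_⊗_ : Elem → Elem → Elem) → (∀ {x y} → x ∈ K → y ∈ K → (x ⊗ y) ∈ K) →
                 ∀ {xs ys} → All (_∈ K) xs → All (_∈ K) ys → All (_∈ K) (cartesianProductWith _⊗_ xs ys)
      products _⊗_ closed {xs} {ys} xs∈ ys∈ = All.tabulate λ v∈ →
        let x , y , x∈ , y∈ , v≡ = ∈-cartesianProductWith⁻ _⊗_ xs ys v∈
        in ≡.subst (_∈ K) (≡.sym v≡) (closed (All.lookup xs∈ x∈) (All.lookup ys∈ y∈))

      shift : ∀ s f r a → f ⁻¹ ∙ ((s ∙ r) ∙ a) ≈ (s ⁻¹ ∙ f) ⁻¹ ∙ (r ∙ a)
      shift s f r a = ≡.sym (≡.trans
        (∙-congʳ {r ∙ a} {(s ⁻¹ ∙ f) ⁻¹} {f ⁻¹ ∙ s} (⁻¹-anti-homo-\\ s f))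
        (≡.trans (assoc (f ⁻¹) s (r ∙ a)) (∙-congˡ {f ⁻¹} {s ∙ (r ∙ a)} {(s ∙ r) ∙ a} (≡.sym (assoc s r a)))))

    -- If no translate of ss lies in fs ✶ (D ∩ E), each one that lies in fs ✶ D meets fs ✶ (D ∩ ∁ E).
    thick-or-big : ∀ {D E : Subset} {fs} → D Respects _≈_ → E Respects _≈_ →
                   All (_∈ K) fs → Thick (fs ✶ D) →
                   Thick (fs ✶ (D ∩ E)) ⊎ Big (D ∩ ∁ E)
    thick-or-big {D} {E} {fs} D-resp E-resp fs∈ thick with dec (Thick (fs ✶ (D ∩ E)))
    ... | yes p = inj₁ p
    ... | no ¬p with ¬∀⇒∃¬ ¬p
    ...   | ss , q with ¬∀⇒∃¬ q
    ...     | ss∈ , ¬translate = inj₂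
      ( cartesianProductWith _\\ᴳ_ ss fs
      , products _\\ᴳ_ (λ x∈ y∈ → ∙-closed (⁻¹-closed x∈) y∈) ss∈ fs∈
      , λ rs rs∈ →
          let a , a∈ = thick (cartesianProductWith _∙_ ss rs) (products _∙_ ∙-closed ss∈ rs∈)
          in a , All.tabulate λ r∈ → split a _ λ s∈ → All.lookup a∈ (∈-cartesianProductWith⁺ _∙_ s∈ r∈) )
      where
      _\\ᴳ_ : Elem → Elem → Elem
      x \\ᴳ y = x ⁻¹ ∙ y

      split : ∀ a r → (∀ {s} → s ∈ˡ ss → (s ∙ r) ∙ a ∈ fs ✶ D) →
              r ∙ a ∈ cartesianProductWith _\\ᴳ_ ss fs ✶ (D ∩ ∁ E)
      split a r in-fsD =
        let s , s∈ , s∉ = find (All.¬All⇒Any¬ (λ s → dec (s ∙ (r ∙ a) ∈ fs ✶ (D ∩ E))) ss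
                                  (λ h → ¬translate (r ∙ a , h)))
            f , f∈ , d∈ = find (in-fsD s∈)
            same = ∙-congˡ {f ⁻¹} {(s ∙ r) ∙ a} {s ∙ (r ∙ a)} (assoc s r a)
        in lose (∈-cartesianProductWith⁺ _\\ᴳ_ s∈ f∈)
             ( D-resp {f ⁻¹ ∙ ((s ∙ r) ∙ a)} {(s ⁻¹ ∙ f) ⁻¹ ∙ (r ∙ a)} (shift s f r a) d∈
             , λ e∈ → s∉ (lose f∈
                 ( D-resp {f ⁻¹ ∙ ((s ∙ r) ∙ a)} {f ⁻¹ ∙ (s ∙ (r ∙ a))} same d∈
                 , E-resp {(s ⁻¹ ∙ f) ⁻¹ ∙ (r ∙ a)} {f ⁻¹ ∙ (s ∙ (r ∙ a))}
                     (≡.trans (≡.sym (shift s f r a)) same) e∈)) )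

    Big-self : Big K
    Big-self = ε ∷ [] , ε-closed ∷ [] , λ ss ss∈ → ε , All.map
      (λ s∈ → here (∙-closed (⁻¹-closed ε-closed) (∙-closed s∈ ε-closed))) ss∈

    Big⇒inhabited : ∀ {D : Subset} → Big D → ∃ λ x → x ∈ D
    Big⇒inhabited (fs , _ , thick) with thick (ε ∷ []) (ε-closed ∷ [])
    ... | a , any ∷ [] = let _ , _ , x∈ = find any in _ , x∈

    -- One exponent for all good sets, as in (2) and (3); this is not the boundedness of an index.
    Bounded : Set ℓ
    Bounded = ∃ λ m → ∀ φ → Good φ → K ⊆ ⟦ φ ⟧ ^ m

    module _ (K⊆U : K ⊆ U) where
      finite⊆^ : ∀ {fs} → All (_∈ K) fs → ∃ λ m → ∀ φ → Good φ → All (_∈ ⟦ φ ⟧ ^ m) fs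
      finite⊆^ []          = 0 , λ _ _ → []
      finite⊆^ (f∈ ∷ fs∈) =
        let m , h = K⊆U f∈
            n , hs = finite⊆^ fs∈
        in m + n , λ φ good → Good-+ʳ good m n (h φ good) ∷ All.map (Good-+ˡ good m n) (hs φ good)

      -- Thickness applied to `ε` and `g` gives `a` and `g ∙ a` in translates by `fs` of the `n`-th
      -- power. As `fs` lies in a `j`-th power with `j` independent of `φ`, the quotient `g` lies in
      -- the power `2(j + n)`.
      all-thick⇒bounded : ∀ {D : Subset} {fs} n → All (_∈ K) fs →
        (∀ φ → Good φ → Thick (fs ✶ (D ∩ (⟦ φ ⟧ ^ n)))) → Bounded
      all-thick⇒bounded {D} {fs} n fs∈ thick =
        let j , fs⊆ = finite⊆^ fs∈
        in (j + n) + (j + n) , λ φ good {g} g∈ →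
          let a , ps = thick φ good (ε ∷ g ∷ []) (ε-closed ∷ g∈ ∷ [])
              undo : ∀ {z} → z ∈ fs ✶ (D ∩ (⟦ φ ⟧ ^ n)) → z ∈ ⟦ φ ⟧ ^ (j + n)
              undo {z} z∈ = let f , f∈ , _ , d∈ = find z∈ in
                ^-resp (j + n) {f ∙ (f ⁻¹ ∙ z)} {z} (\\-leftDividesˡ f z)
                  (∙-^ j n (All.lookup (fs⊆ φ good) f∈) d∈)
          in ^-resp ((j + n) + (j + n)) {(g ∙ a) ∙ (ε ∙ a) ⁻¹} {g}
               (≡.trans (∙-congˡ {g ∙ a} {(ε ∙ a) ⁻¹} {a ⁻¹} (⁻¹-cong {ε ∙ a} {a} (identityˡ a)))
                        (//-rightDividesʳ a g))
               (∙-^ (j + n) (j + n) (undo {g ∙ a} (All.head (All.tail ps)))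
                 (^-⁻¹ (λ {x} → Good-⁻¹ good {x}) (j + n) (undo {ε ∙ a} (All.head ps))))

      -- Otherwise remove from K, one after another, powers ⟦ φₙ ⟧ⁿ leaving a big set at every
      -- stage; by saturation some element of K is in none of them, so it is not in U.
      module _ (K-typeDefinable : TypeDefinable K) (¬bounded : ¬ Bounded) where
        private
          -- Otherwise `thick-or-big` gives thickness for every good `φ` with the same `fs` and `n`,
          -- and `K` would be bounded.
          removable : ∀ {D} n → D Respects _≈_ → Big D → ∃ λ φ → Good φ × Big (D ∩ ∁ (⟦ φ ⟧ ^ n))
          removable {D} n D-resp (fs , fs∈ , thick) = stable λ ¬∃ → ¬bounded
            (all-thick⇒bounded {D} n fs∈ λ φ good → [ id , (λ big → contradiction (φ , good , big) ¬∃) ]′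
              (thick-or-big (λ {x} {y} → D-resp {x} {y}) (λ {x} {y} → ^-resp {⟦ φ ⟧} n {x} {y}) fs∈ thick))

          record Stage : Set (lsuc ℓ) where
            field
              set   : Subset
              ⊆K    : set ⊆ K
              resp′ : set Respects _≈_
              big   : Big set

          stage : ℕ → Stage
          removed : ∀ n → ∃ λ φ → Good φ × Big (Stage.set (stage n) ∩ ∁ (⟦ φ ⟧ ^ n))

          stage zero    = record { set = K ; ⊆K = id ; resp′ = respects ; big = Big-self }
          stage (suc n) = let φ , good , big = removed n in record
            -- Stage `suc n` excludes the `n`-th power, so the power with index `i` is avoided from
            -- stage `suc i` on.
            { set   = Stage.set (stage n) ∩ ∁ (⟦ φ ⟧ ^ n)
            ; ⊆K    = λ (x∈ , _) → Stage.⊆K (stage n) x∈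
            ; resp′ = λ {x} {y} x≈y (x∈ , x∉) →
                Stage.resp′ (stage n) {x} {y} x≈y x∈ , λ y∈ → x∉ (^-resp n {y} {x} (≡.sym x≈y) y∈)
            ; big   = big
            }
          removed n = removable n (λ {x} {y} → Stage.resp′ (stage n) {x} {y}) (Stage.big (stage n))

          D : ℕ → Subset
          D n = Stage.set (stage n)

          D-antitone : ∀ m n → D (m + n) ⊆ D n
          D-antitone zero    n x∈ = x∈
          D-antitone (suc m) n (x∈ , _) = D-antitone m n x∈

          φ : ℕ → Formula dim
          φ n = proj₁ (removed n)

          Γ = proj₁ K-typeDefinable
          K⇔Γ = proj₂ K-typeDefinable

          Constraint : Set ℓ
          Constraint = ∃ Γ ⊎ ℕ

          constraint : Constraint → Formula dim
          constraint (inj₁ (γ , _)) = and carrier γ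
          constraint (inj₂ n)       = and carrier (neg (powᶠ (φ n) n))

          pad : Formula dim → Formula (dim + 0)
          pad = ren (_↑ˡ 0)

          pad⇔ : ∀ {xs} ψ → (xs ++ [] ⊨ pad ψ) ⇔ (xs ⊨ ψ)
          pad⇔ {xs} ψ = ⊨-ren-≡ (_↑ˡ 0) (xs ++ []) ψ (reindex-↑ˡ xs [])

          -- The stages decrease, so a late enough one satisfies any finite list of constraints.
          D⊨constraints : ∀ is → ∃ λ n → ∀ {x} → x ∈ D n → All (λ i → proj₁ x ++ [] ⊨ pad (constraint i)) is
          D⊨constraints [] = 0 , λ _ → []
          D⊨constraints (inj₁ (γ , γ∈Γ) ∷ is) = let n , h = D⊨constraints is in n , λ {x} x∈ →
            from (pad⇔ (and carrier γ)) (proj₂ x , to (K⇔Γ x) (Stage.⊆K (stage n) x∈) γ γ∈Γ) ∷ h {x} x∈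
          D⊨constraints (inj₂ i ∷ is) = let n , h = D⊨constraints is in suc i + n , λ {x} x∈ →
            from (pad⇔ (constraint (inj₂ i)))
              (proj₂ x , λ p → proj₂ (D-antitone n (suc i) (≡.subst (λ k → x ∈ D k) (+-comm (suc i) n) x∈))
                                 (to (⊨-powᶠ (φ i) i x) p))
            ∷ h {x} (D-antitone (suc i) n x∈)

        ¬bounded⇒⊥ : ⊥
        ¬bounded⇒⊥ =
          let xs , xs⊨ = saturation-over-tuple [] (pad ∘ constraint) λ is →
                let n , h = D⊨constraints is
                    x , x∈ = Big⇒inhabited {D n} (Stage.big (stage n))
                in proj₁ x , h {x} x∈
              satisfies : ∀ i → xs ⊨ constraint i
              satisfies i = to (pad⇔ (constraint i)) (xs⊨ i)
              x : Elem
              x = xs , proj₁ (satisfies (inj₂ 0))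
              -- The exponent `n` serves all good sets, in particular `φ n`, whose `n`-th power is
              -- excluded by the constraint for `n`.
              n , h = K⊆U {x} (from (K⇔Γ x) λ γ γ∈Γ → proj₂ (satisfies (inj₁ (γ , γ∈Γ))))
          in proj₂ (satisfies (inj₂ n)) (from (⊨-powᶠ (φ n) n x) (h (φ n) (proj₁ (proj₂ (removed n)))))

      typeDefinable⇒bounded : TypeDefinable K → Bounded
      typeDefinable⇒bounded K-typeDefinable = stable (¬bounded⇒⊥ K-typeDefinable)

  -- Fine sets

  ⁻¹∙∈X² : ∀ {a b} → a ∈ X → b ∈ X → a ⁻¹ ∙ b ∈ ⟦ powᶠ χ 2 ⟧
  ⁻¹∙∈X² {a} {b} a∈ b∈ = from (⊨-powᶠ χ 2 (a ⁻¹ ∙ b))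
    (^-mono {X} {⟦ χ ⟧} 2 (λ {x} → to (X⇔χ x)) {a ⁻¹ ∙ b} (∙-^ 1 1 (⊆-^1 (X-⁻¹ a∈)) (⊆-^1 b∈)))

  X²-⁻¹ : ∀ {x} → x ∈ ⟦ powᶠ χ 2 ⟧ → x ⁻¹ ∈ ⟦ powᶠ χ 2 ⟧
  X²-⁻¹ {x} x∈ = from (⊨-powᶠ χ 2 (x ⁻¹))
    (^-⁻¹ (λ {y} → Good-⁻¹ χ-good {y}) 2 (to (⊨-powᶠ χ 2 x) x∈))

  -- Pairing colours makes fineness pass to intersections, whereas an intersection of generic sets
  -- can fail to be generic.
  record Fine (φ : Formula dim) : Set ℓ where
    field
      contained   : ⟦ φ ⟧ ⊆ H
      ⁻¹-closed   : ∀ x → x ∈ ⟦ φ ⟧ → x ⁻¹ ∈ ⟦ φ ⟧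
      colours     : ℕ
      colour      : Elem → Fin colours
      same-colour : ∀ {a b} → a ∈ X → b ∈ X → colour a ≡ colour b → a ⁻¹ ∙ b ∈ ⟦ φ ⟧

  Fine-X² : Fine (powᶠ χ 2)
  Fine-X² = record
    { contained   = λ {x} x∈ → X^⊆H 2 {x} (^-mono {⟦ χ ⟧} 2 (λ {y} → from (X⇔χ y)) {x} (to (⊨-powᶠ χ 2 x) x∈))
    ; ⁻¹-closed   = λ x → X²-⁻¹ {x}
    ; colours     = 1
    ; colour      = λ _ → zero
    ; same-colour = λ {a} {b} a∈ b∈ _ → ⁻¹∙∈X² {a} {b} a∈ b∈
    }

  Fine-∩ : ∀ {φ ψ} → Fine φ → Fine ψ → Fine (and φ ψ)
  Fine-∩ F F′ = record
    { contained   = λ {x} (p , _) → Fine.contained F {x} p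
    ; ⁻¹-closed   = λ x (p , q) → Fine.⁻¹-closed F x p , Fine.⁻¹-closed F′ x q
    ; colours     = _
    ; colour      = λ a → combine (Fine.colour F a) (Fine.colour F′ a)
    ; same-colour = λ {a} {b} a∈ b∈ e →
        Fine.same-colour F a∈ b∈ (combine-injectiveˡ (Fine.colour F a) (Fine.colour F′ a) (Fine.colour F b) _ e) ,
        Fine.same-colour F′ a∈ b∈ (combine-injectiveʳ (Fine.colour F a) (Fine.colour F′ a) (Fine.colour F b) _ e)
    }

  Fine⇒Good : ∀ {φ} → Fine φ → Good φ
  Fine⇒Good {φ} F = record
    { contained = λ {x} → contained {x}
    ; generic   = record
      { translates     = List.map pick (allFin colours)
      ; translates⊆⟨X⟩ = All.map⁺ (All.tabulate λ {k} _ → incl (pick∈X k))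
      ; covers         = λ {z} z∈ → lose (∈-map⁺ pick (∈-allFin (colour z)))
          ( pick (colour z) ⁻¹ ∙ z
          , same-colour (pick∈X (colour z)) z∈ (pick-colour z∈)
          , ≡.sym (\\-leftDividesˡ (pick (colour z)) z) )
      }
    ; symmetric = ⁻¹-closed⇒symmetric (λ {x} {y} → ⟦⟧-resp φ {x} {y}) (λ {x} → ⁻¹-closed x)
        (⟦⟧-resp φ {ε ⁻¹ ∙ ε} {ε} (inverseˡ ε) (same-colour ε∈X ε∈X refl))
    }
    where
    open Fine F
    pick : Fin colours → Elem
    -- One translate for each colour; a colour absent from `X` gets the default `ε`.
    pick k with dec (∃ λ a → a ∈ X × colour a ≡ k)
    ... | yes (a , _) = a
    ... | no _        = ε

    pick∈X : ∀ k → pick k ∈ X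
    pick∈X k with dec (∃ λ a → a ∈ X × colour a ≡ k)
    ... | yes (_ , a∈ , _) = a∈
    ... | no _             = ε∈X

    pick-colour : ∀ {z} → z ∈ X → colour (pick (colour z)) ≡ colour z
    pick-colour {z} z∈ with dec (∃ λ a → a ∈ X × colour a ≡ colour z)
    ... | yes (_ , _ , e) = e
    ... | no ¬∃           = contradiction (z , z∈ , refl) ¬∃

  FineKernel : Subset
  FineKernel x = ∀ φ → Fine φ → x ∈ ⟦ φ ⟧

  -- The colour is the tuple of truth values of the finitely many predicates.
  finite-colouring : ∀ {I : Set ℓ} (Q : I → Subset) is → ∃ λ n → ∃ λ (c : Elem → Fin n) →
                     ∀ {a b} → c a ≡ c b → All (λ i → a ∈ Q i → b ∈ Q i) is
  finite-colouring Q []       = 1 , (λ _ → zero) , λ _ → []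
  finite-colouring Q (i ∷ is) =
    let n , c , h = finite-colouring Q is
    in _ , (λ a → combine (bit (char (a ∈ Q i))) (c a)) , λ {a} {b} e →
         char-cong⁻ (bit-injective (combine-injectiveˡ (bit (char (a ∈ Q i))) (c a) (bit (char (b ∈ Q i))) (c b) e))
         ∷ h (combine-injectiveʳ (bit (char (a ∈ Q i))) (c a) (bit (char (b ∈ Q i))) (c b) e)
    where
    bit : Bool → Fin 2
    bit false = zero
    bit true  = suc zero

    bit-injective : ∀ {p q} → bit p ≡ bit q → p ≡ q
    bit-injective {false} {false} _ = refl
    bit-injective {true}  {true}  _ = refl

  -- If x lies in every fine set then θ cannot be avoided by the quotients a⁻¹b of
  -- elements of the same colour: otherwise X² ∩ ∁ θ ∩ (∁ θ)⁻¹ would be fine.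
  FineKernel⇒monochromatic : ∀ {x} → x ∈ FineKernel → ∀ θ → x ∈ ⟦ θ ⟧ → ∀ {n} (c : Elem → Fin n) →
    ∃ λ a → ∃ λ b → a ∈ X × b ∈ X × c a ≡ c b × a ⁻¹ ∙ b ∈ ⟦ θ ⟧
  FineKernel⇒monochromatic {x} x∈ θ x∈θ {n} c = stable λ ¬∃ →
    proj₁ (proj₂ (x∈ ζ (ζ-fine ¬∃))) x∈θ
    where
    ζ : Formula dim
    ζ = and (powᶠ χ 2) (and (neg θ) (neg (invᶠ θ)))

    ζ-fine : ¬ _ → Fine ζ
    ζ-fine ¬∃ = record
      { contained   = λ {x} (p , _) → Fine.contained Fine-X² {x} p
      ; ⁻¹-closed   = λ x (p , q , r) → X²-⁻¹ {x} p , (λ t → r (from (⊨-invᶠ θ x) t)) ,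
          λ t → q (⟦⟧-resp θ {(x ⁻¹) ⁻¹} {x} (⁻¹-involutive x) (to (⊨-invᶠ θ (x ⁻¹)) t))
      ; colours     = n
      ; colour      = c
      ; same-colour = λ {a} {b} a∈ b∈ e → ⁻¹∙∈X² {a} {b} a∈ b∈ ,
          (λ t → ¬∃ (a , b , a∈ , b∈ , e , t)) ,
          λ t → ¬∃ (b , a , b∈ , a∈ , ≡.sym e ,
            ⟦⟧-resp θ {(a ⁻¹ ∙ b) ⁻¹} {b ⁻¹ ∙ a} (⁻¹-anti-homo-\\ a b) (to (⊨-invᶠ θ (a ⁻¹ ∙ b)) t))
      }

  blockᵣ : Fin dim → Fin (dim + dim)
  blockᵣ = dim ↑ʳ_

  -- The fine kernel and invariant subgroups of bounded index

  module _ {K : Subset} (K-bounded : BoundedIndexSubgroup κ H K) (K-invariant : Invariant K) where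
    open BoundedIndexSubgroup K-bounded

    private
      H/K = cosets H isSubgroup

      rep : Σ Elem H → Vec Dom dim
      rep h = proj₁ (proj₁ (representative H/K h))

      RepEntry : Fin dim → Pred Dom ℓ
      RepEntry i d = ∃ λ h → d ≡ lookup (rep h) i

      RepEntries : Pred Dom ℓ
      RepEntries d = ∃ λ i → d ∈ RepEntry i

      -- A representative depends only on its coset, so different `i`-th entries come from different
      -- cosets. A copy of `κ` among the entries would embed `κ` into `H / K`.
      repEntries-small : Small RepEntries
      repEntries-small = finite-union-small RepEntry λ i (f , f-injective , f∈) → proj₂ bounded record
        { to        = λ k → proj₁ (f∈ k)
        ; cong      = λ { {k} refl → Setoid.refl H/K {proj₁ (f∈ k)} }
        ; injective = λ {k} {l} e → f-injective (≡.trans (proj₂ (f∈ k))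
            (≡.trans (≡.cong (λ r → lookup (proj₁ (proj₁ r)) i) (representative-cong H/K e)) (≡.sym (proj₂ (f∈ l)))))
        }

      repParams : Σ Elem H → Vec (Σ Dom RepEntries) dim
      repParams h = tabulate λ i → lookup (rep h) i , i , h , refl

      map-repParams : ∀ h → map proj₁ (repParams h) ≡ rep h
      map-repParams h = ≡.trans (≡.sym (tabulate-∘ proj₁ _)) (tabulate∘lookup (rep h))

      pairᶠ : Formula dim → Formula (dim + dim)
      pairᶠ θ = and (ren block₀ (and carrier χ)) (and (ren blockᵣ (and carrier χ)) (divᶠ θ))

      transfer : Formula (dim + dim) → Formula ((dim + dim) + dim)
      transfer φ = neg (and (ren (((_↑ˡ dim) ∘ block₀) ⊕ ((dim + dim) ↑ʳ_)) φ)
                            (neg (ren (((_↑ˡ dim) ∘ blockᵣ) ⊕ ((dim + dim) ↑ʳ_)) φ)))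

      condition : Formula dim → Formula (dim + dim) → Formula ((dim + dim) + dim)
      condition θ φ = and (ren (_↑ˡ dim) (pairᶠ θ)) (transfer φ)

      module _ (a b : Elem) (m : Vec Dom dim) where
        private
          ab  = proj₁ a ++ proj₁ b
          abm = ab ++ m

          reindex-am : reindex (((_↑ˡ dim) ∘ block₀) ⊕ ((dim + dim) ↑ʳ_)) abm ≡ proj₁ a ++ m
          reindex-am = ≡.trans (reindex-⊕ ((_↑ˡ dim) ∘ block₀) ((dim + dim) ↑ʳ_) abm) (≡.cong₂ _++_
            (≡.trans (reindex-∘ block₀ (_↑ˡ dim) abm)
              (≡.trans (≡.cong (reindex block₀) (reindex-↑ˡ ab m)) (reindex-↑ˡ (proj₁ a) (proj₁ b))))
            (reindex-↑ʳ ab m))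

          reindex-bm : reindex (((_↑ˡ dim) ∘ blockᵣ) ⊕ ((dim + dim) ↑ʳ_)) abm ≡ proj₁ b ++ m
          reindex-bm = ≡.trans (reindex-⊕ ((_↑ˡ dim) ∘ blockᵣ) ((dim + dim) ↑ʳ_) abm) (≡.cong₂ _++_
            (≡.trans (reindex-∘ blockᵣ (_↑ˡ dim) abm)
              (≡.trans (≡.cong (reindex blockᵣ) (reindex-↑ˡ ab m)) (reindex-↑ʳ (proj₁ a) (proj₁ b))))
            (reindex-↑ʳ ab m))

        condition⁺ : ∀ θ φ → a ∈ X → b ∈ X → a ⁻¹ ∙ b ∈ ⟦ θ ⟧ →
                     (proj₁ a ++ m ⊨ φ → proj₁ b ++ m ⊨ φ) → abm ⊨ condition θ φ
        condition⁺ θ φ a∈ b∈ t f =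
          from (⊨-ren-≡ (_↑ˡ dim) abm (pairᶠ θ) (reindex-↑ˡ ab m))
            ( from (⊨-ren-≡ block₀ ab (and carrier χ) (reindex-↑ˡ (proj₁ a) (proj₁ b))) (proj₂ a , to (X⇔χ a) a∈)
            , from (⊨-ren-≡ blockᵣ ab (and carrier χ) (reindex-↑ʳ (proj₁ a) (proj₁ b))) (proj₂ b , to (X⇔χ b) b∈)
            , from (⊨-divᶠ θ a b) t )
          , λ (p , ¬q) → ¬q (from (⊨-ren-≡ _ abm φ reindex-bm) (f (to (⊨-ren-≡ _ abm φ reindex-am) p)))

        condition⁻ : ∀ θ φ → abm ⊨ condition θ φ →
                     a ⁻¹ ∙ b ∈ ⟦ θ ⟧ × (proj₁ a ++ m ⊨ φ → proj₁ b ++ m ⊨ φ)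
        condition⁻ θ φ (p , q) =
          to (⊨-divᶠ θ a b) (proj₂ (proj₂ (to (⊨-ren-≡ (_↑ˡ dim) abm (pairᶠ θ) (reindex-↑ˡ ab m)) p))) ,
          λ r → stable λ ¬s → q ( from (⊨-ren-≡ _ abm φ reindex-am) r
                                , λ s → ¬s (to (⊨-ren-≡ _ abm φ reindex-bm) s) )

      condition-X : ∀ (a b m : Vec Dom dim) θ φ → (a ++ b) ++ m ⊨ condition θ φ →
                    (a ⊨ and carrier χ) × (b ⊨ and carrier χ)
      condition-X a b m θ φ (p , _) =
        let q , r , _ = to (⊨-ren-≡ (_↑ˡ dim) ((a ++ b) ++ m) (pairᶠ θ) (reindex-↑ˡ (a ++ b) m)) p
        in to (⊨-ren-≡ block₀ (a ++ b) (and carrier χ) (reindex-↑ˡ a b)) q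
         , to (⊨-ren-≡ blockᵣ (a ++ b) (and carrier χ) (reindex-↑ʳ a b)) r

    -- An automorphism fixing the representative of aK and taking a to b shows that b ∈ aK.
    conjugate-over-rep : ∀ (a b : Elem) (a∈H : a ∈ H) →
      (∀ φ → proj₁ a ++ rep (a , a∈H) ⊨ φ → proj₁ b ++ rep (a , a∈H) ⊨ φ) → b ∈ H → a ⁻¹ ∙ b ∈ K
    conjugate-over-rep a b a∈H a→b b∈H =
      Setoid.trans H/K {a , a∈H} {r} {b , b∈H} (representative-≈ H/K (a , a∈H))
        (K-invariant σ (r₁ ⁻¹ ∙ a) (r₁ ⁻¹ ∙ b) (≡.sym moved)
          (Setoid.sym H/K {a , a∈H} {r} (representative-≈ H/K (a , a∈H))))
      where
      r = representative H/K (a , a∈H)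
      r₁ = proj₁ r
      conj = conjugate (proj₁ a ++ proj₁ r₁) (proj₁ b ++ proj₁ r₁) a→b
      σ = proj₁ conj
      split = ++-injective (map (Automorphism.to σ) (proj₁ a)) (proj₁ b)
                (≡.trans (≡.sym (map-++ (Automorphism.to σ) (proj₁ a) (proj₁ r₁))) (proj₂ conj))

      moved : applyTo σ (r₁ ⁻¹ ∙ a) ≈ r₁ ⁻¹ ∙ b
      moved = y≈x\\z r₁ (applyTo σ (r₁ ⁻¹ ∙ a)) b
        (≡.trans (∙-congʳ {applyTo σ (r₁ ⁻¹ ∙ a)} {r₁} {applyTo σ r₁} (≡.sym (proj₂ split)))
        (≡.trans (≡.sym (applyTo-homo σ r₁ (r₁ ⁻¹ ∙ a)))
        (≡.trans (≡.cong (map (Automorphism.to σ)) (\\-leftDividesˡ r₁ a)) (proj₁ split))))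

    -- Saturation yields `a` and `b` in `X` such that `a ⁻¹ ∙ b` has the type of `g` and `b`
    -- satisfies every formula over each representative that `a` does; monochromatic pairs give
    -- finite satisfiability. Then `a ⁻¹ ∙ b` is in `K`, and an automorphism carries it to `g`.
    FineKernel⊆K : FineKernel ⊆ K
    FineKernel⊆K {g} g∈ = K-invariant τ (a ⁻¹ ∙ b) g (≡.sym (proj₂ conj))
      (conjugate-over-rep a b a∈H
        (λ φ → proj₂ (condition⁻ a b (rep (a , a∈H)) carrier φ (holds carrier (proj₂ g) (a , a∈H) φ)))
        b∈H)
      where
      Index : Set ℓ
      -- The coset of `a` is not known in advance, so the constraints run through the
      -- representatives of all cosets, one at a time.
      Index = (∃ λ θ → g ∈ ⟦ θ ⟧) × Σ Elem H × Formula (dim + dim)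

      constraint : Index → FormulaOver RepEntries (dim + dim)
      constraint ((θ , _) , h , φ) = record { formula = condition θ φ ; params = repParams h }

      Q : Index → Subset
      Q (_ , h , φ) a = proj₁ a ++ rep h ⊨ φ

      conj-θ : List Index → Formula dim
      conj-θ = foldr (λ ((θ , _) , _) → and θ) carrier

      g∈conj-θ : ∀ is → g ∈ ⟦ conj-θ is ⟧
      g∈conj-θ []                  = proj₂ g
      g∈conj-θ (((_ , p) , _) ∷ is) = p , g∈conj-θ is

      conditions : ∀ {a b} is → a ∈ X → b ∈ X → a ⁻¹ ∙ b ∈ ⟦ conj-θ is ⟧ → All (λ i → a ∈ Q i → b ∈ Q i) is →
                   All (λ i → proj₁ a ++ proj₁ b ⊨ₚ constraint i) is
      conditions [] _ _ _ _ = []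
      conditions {a} {b} (((θ , _) , h , φ) ∷ is) a∈ b∈ (t , ts) (f ∷ fs) =
        ≡.subst (λ m → (proj₁ a ++ proj₁ b) ++ m ⊨ condition θ φ) (≡.sym (map-repParams h))
          (condition⁺ a b (rep h) θ φ a∈ b∈ t f)
        ∷ conditions {a} {b} is a∈ b∈ ts fs

      realisation : ∃ λ xs → ∀ i → xs ⊨ₚ constraint i
      realisation = saturation repEntries-small constraint λ is →
        let n , c , c-spec = finite-colouring Q is
            a , b , a∈ , b∈ , ca≡cb , t = FineKernel⇒monochromatic {g} g∈ (conj-θ is) (g∈conj-θ is) c
        in proj₁ a ++ proj₁ b , conditions {a} {b} is a∈ b∈ t (c-spec {a} {b} ca≡cb)

      halves = splitAt dim (proj₁ realisation)
      as = proj₁ halves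
      bs = proj₁ (proj₂ halves)

      holds : ∀ θ → g ∈ ⟦ θ ⟧ → ∀ h φ → (as ++ bs) ++ rep h ⊨ condition θ φ
      holds θ t h φ = ≡.subst₂ (λ xs m → xs ++ m ⊨ condition θ φ) (proj₂ (proj₂ halves)) (map-repParams h)
        (proj₂ realisation ((θ , t) , h , φ))

      -- Only membership in `X` is extracted; the coset of `ε` and both formulas are arbitrary
      -- fillers.
      inX = condition-X as bs (rep (ε , unit)) carrier (divᶠ carrier)
              (holds carrier (proj₂ g) (ε , unit) (divᶠ carrier))

      a b : Elem
      a = as , proj₁ (proj₁ inX)
      b = bs , proj₁ (proj₂ inX)

      a∈H : a ∈ H
      a∈H = incl (from (X⇔χ a) (proj₂ (proj₁ inX)))

      b∈H : b ∈ H
      b∈H = incl (from (X⇔χ b) (proj₂ (proj₂ inX)))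

      quotient-type : ∀ θ → g ∈ ⟦ θ ⟧ → a ⁻¹ ∙ b ∈ ⟦ θ ⟧
      quotient-type θ t =
        proj₁ (condition⁻ a b (rep (ε , unit)) θ (divᶠ carrier) (holds θ t (ε , unit) (divᶠ carrier)))

      -- Passing to negations reverses the inclusion of types given by `quotient-type`.
      conj = conjugate (proj₁ (a ⁻¹ ∙ b)) (proj₁ g) λ φ p → stable λ ¬p → quotient-type (neg φ) ¬p p
      τ = proj₁ conj

    private
      factor : Formula dim → ℕ → Formula (dim + dim)
      factor φ n = and (ren block₀ (and carrier φ)) (divᶠ (powᶠ φ n))

    -- A single factor `y` must serve all fine sets at once. For finitely many of them it is found
    -- inside their intersection, which is fine; saturation does the rest.
    split-power : ∀ n {x} → (∀ φ → Fine φ → x ∈ ⟦ φ ⟧ ^ suc n) →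
                  ∃ λ y → y ∈ FineKernel × (∀ φ → Fine φ → y ⁻¹ ∙ x ∈ ⟦ φ ⟧ ^ n)
    split-power n {x} x∈ = y ,
      (λ φ F → proj₂ (to (at φ) (proj₁ (proj₂ realisation (φ , F))))) ,
      (λ φ F → to (⊨-powᶠ φ n (y ⁻¹ ∙ x)) (to (⊨-divᶠ (powᶠ φ n) y x) (proj₂ (proj₂ realisation (φ , F)))))
      where
      meet : ∀ is → ∃ λ φ → Fine φ × All (λ i → ⟦ φ ⟧ ⊆ ⟦ proj₁ i ⟧) is
      meet []             = powᶠ χ 2 , Fine-X² , []
      meet ((φ , F) ∷ is) =
        let ψ , F′ , h = meet is
        in and φ ψ , Fine-∩ F F′ , proj₁ ∷ All.map (λ s {z} (_ , q) → s {z} q) h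

      realisation : ∃ λ ys → ∀ (i : ∃ Fine) → ys ++ proj₁ x ⊨ factor (proj₁ i) n
      realisation = saturation-over-tuple (proj₁ x) (λ i → factor (proj₁ i) n) λ is →
        let ψ , F , ψ⊆ = meet is
            y , z , y∈ , z∈ , x≈yz = x∈ ψ F
        in proj₁ y , All.map (λ {i} ψ⊆φ → let φ = proj₁ i in
             from (⊨-ren-≡ block₀ (proj₁ y ++ proj₁ x) (and carrier φ) (reindex-↑ˡ (proj₁ y) (proj₁ x)))
               (proj₂ y , ψ⊆φ {y} y∈) ,
             from (⊨-divᶠ (powᶠ φ n) y x) (from (⊨-powᶠ φ n (y ⁻¹ ∙ x))
               (^-resp n {z} {y ⁻¹ ∙ x} (y≈x\\z y z x (≡.sym x≈yz)) (^-mono n (λ {w} → ψ⊆φ {w}) z∈)))) ψ⊆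

      ys = proj₁ realisation

      at : ∀ φ → (ys ++ proj₁ x ⊨ ren block₀ (and carrier φ)) ⇔ (ys ⊨ and carrier φ)
      at φ = ⊨-ren-≡ block₀ (ys ++ proj₁ x) (and carrier φ) (reindex-↑ˡ ys (proj₁ x))

      y : Elem
      y = ys , proj₁ (to (at (powᶠ χ 2)) (proj₁ (proj₂ realisation (_ , Fine-X²))))

    FinePowers⊆K : ∀ n {x} → (∀ φ → Fine φ → x ∈ ⟦ φ ⟧ ^ n) → x ∈ K
    FinePowers⊆K zero {x} x∈ =
      -- A zeroth power does not depend on the set, so any fine set gives `x ≈ ε`.
      IsSubgroup.respects isSubgroup {ε} {x} (≡.sym (x∈ _ Fine-X²)) (IsSubgroup.ε-closed isSubgroup)
    FinePowers⊆K (suc n) {x} x∈ =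
      let y , y∈ , z∈ = split-power n {x} x∈
      in IsSubgroup.respects isSubgroup {y ∙ (y ⁻¹ ∙ x)} {x} (\\-leftDividesˡ y x)
           (IsSubgroup.∙-closed isSubgroup (FineKernel⊆K {y} y∈) (FinePowers⊆K n {y ⁻¹ ∙ x} z∈))

    -- `K` is squeezed: it lies in the `n`-th power of every fine set, and the intersection of these
    -- powers lies in `K` by `FinePowers⊆K`.
    Good-bounded⇒typeDefinable : ∀ n → (∀ φ → Good φ → K ⊆ ⟦ φ ⟧ ^ n) → TypeDefinable K
    Good-bounded⇒typeDefinable n K⊆ = (λ ψ → ∃ λ φ → Fine φ × ψ ≡ powᶠ φ n) , λ x → mk⇔
      (λ { x∈ _ (φ , F , refl) → from (⊨-powᶠ φ n x) (K⊆ φ (Fine⇒Good F) x∈) })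
      (λ h → FinePowers⊆K n {x} λ φ F → to (⊨-powᶠ φ n x) (h _ (φ , F , refl)))

  -- The equivalence of the three conditions

  ContainedInPowers : Subset → Set (lsuc ℓ)
  ContainedInPowers B = ∃ λ m → m ≥ 1 ×
    (∀ (Y : Subset) → Definable Y → Y ⊆ H → Generic X Y → Symmetric Y → B ⊆ Y ^ m)

  Bounded⇒containedInPowers : ∀ {K : Subset} (K-subgroup : IsSubgroup K) → Bounded K-subgroup → ContainedInPowers K
  -- The successor secures an exponent of at least 1; powers of good sets increase because these
  -- contain `ε`.
  Bounded⇒containedInPowers K-subgroup (m , K⊆) = suc m , s≤s z≤n ,
    λ Y Y-def@(φ , Y⇔φ) Y⊆H Y-generic Y-sym {x} x∈ →
    let good : Good φ
        good = record
          { contained = λ {x} x∈ → Y⊆H (from (Y⇔φ x) x∈)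
          ; generic   = record
            { translates     = Generic.translates Y-generic
            ; translates⊆⟨X⟩ = Generic.translates⊆⟨X⟩ Y-generic
            ; covers         = λ {z} z∈ → Any.map (λ (y , y∈ , e) → y , to (Y⇔φ y) y∈ , e)
                                            (Generic.covers Y-generic {z} z∈)
            }
          ; symmetric = ⁻¹-closed⇒symmetric (λ {x} {y} → ⟦⟧-resp φ {x} {y})
              (λ {x} x∈ → to (Y⇔φ (x ⁻¹)) (symmetric⇒⁻¹-closed (Definable-resp Y-def) Y-sym (from (Y⇔φ x) x∈)))
              (to (Y⇔φ ε) (proj₂ Y-sym))
          }
    in ^-mono {⟦ φ ⟧} (suc m) (λ {y} → from (Y⇔φ y)) {x} (Good-+ˡ good 1 m (K⊆ φ good x∈))

  containedInPowers⇒bounded : ∀ {K : Subset} (K-subgroup : IsSubgroup K) → ContainedInPowers K → Bounded K-subgroup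
  containedInPowers⇒bounded K-subgroup (m , _ , K⊆) = m , λ φ good {x} →
    K⊆ ⟦ φ ⟧ (φ , λ _ → ⇔-id _) (λ {x} → Good.contained good {x}) (Good.generic good) (Good.symmetric good) {x}

  module _ {H⁰⁰⁰ : Subset} (isH⁰⁰⁰ : IsH⁰⁰⁰ κ H H⁰⁰⁰) where
    open BoundedIndexSubgroup

    H⁰⁰⁰⊆typeDefinable : ∀ {K} → BoundedIndexSubgroup κ H K → TypeDefinable K → H⁰⁰⁰ ⊆ K
    H⁰⁰⁰⊆typeDefinable {K} K-bounded K-typeDefinable =
      proj₂ isH⁰⁰⁰ K (K-bounded , TypeDefinable⇒Invariant K-typeDefinable)

    -- `H⁰⁰⁰` becomes type-definable, and it is the smallest such subgroup because type-definable
    -- subgroups are invariant.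
    containedInPowers⇒H⁰⁰ : ContainedInPowers H⁰⁰⁰ → IsH⁰⁰ κ H H⁰⁰⁰
    containedInPowers⇒H⁰⁰ c =
      let (H⁰⁰⁰-bounded , H⁰⁰⁰-invariant) , _ = isH⁰⁰⁰
          m , H⁰⁰⁰⊆ = containedInPowers⇒bounded (isSubgroup H⁰⁰⁰-bounded) c
      in (H⁰⁰⁰-bounded , Good-bounded⇒typeDefinable H⁰⁰⁰-bounded H⁰⁰⁰-invariant m H⁰⁰⁰⊆) ,
         λ K (K-bounded , K-typeDefinable) → H⁰⁰⁰⊆typeDefinable K-bounded K-typeDefinable

    -- Minimality of `H⁰⁰⁰` puts it inside `U`, so the removal argument applies to `H⁰⁰`.
    H⁰⁰-containedInPowers : ∀ {H⁰⁰} → IsH⁰⁰ κ H H⁰⁰ → H⁰⁰ ⊆ H⁰⁰⁰ → ContainedInPowers H⁰⁰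
    H⁰⁰-containedInPowers ((H⁰⁰-bounded , H⁰⁰-typeDefinable) , _) H⁰⁰⊆H⁰⁰⁰ =
      Bounded⇒containedInPowers (isSubgroup H⁰⁰-bounded)
        (typeDefinable⇒bounded (isSubgroup H⁰⁰-bounded)
          (λ x∈ → proj₂ isH⁰⁰⁰ U (U-bounded , U-invariant) (H⁰⁰⊆H⁰⁰⁰ x∈)) H⁰⁰-typeDefinable)

proposition5p6 : (∀ a → ExcludedMiddle a) → (∀ a b → Extensionality a b) →
    ∀ {ℓ} {L : Language ℓ} (ℭ : Structure L) (κ : Set ℓ) →
    Semantics.IsMonster ℭ κ →
    (G : DefinableGroup ℭ) →
    let open DefinableGroupTheory G in
    (X : Subset) → Definable X → ApproximateSubgroup X →
    let H = ⟨ X ⟩ in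
    (H⁰⁰⁰ : Subset) → IsH⁰⁰⁰ κ H H⁰⁰⁰ →
    let cond₁ = ∃ λ H⁰⁰ → IsH⁰⁰ κ H H⁰⁰ × H⁰⁰⁰ ≐ H⁰⁰
        cond₂ = ∃ λ H⁰⁰ → IsH⁰⁰ κ H H⁰⁰ ×
                  (∃ λ m → m ≥ 1 ×
                    (∀ (Y : Subset) → Definable Y → Y ⊆ H → Generic X Y →
                      Symmetric Y → H⁰⁰ ⊆ Y ^ m))
        cond₃ = ∃ λ m → m ≥ 1 ×
                  (∀ (Y : Subset) → Definable Y → Y ⊆ H → Generic X Y →
                    Symmetric Y → H⁰⁰⁰ ⊆ Y ^ m)
    in (cond₁ ⇔ cond₂) × (cond₂ ⇔ cond₃)
proposition5p6 em ext ℭ κ monster G X X-definable X-approximate H⁰⁰⁰ isH⁰⁰⁰ =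
  mk⇔ (λ (H⁰⁰ , isH⁰⁰ , _ , H⁰⁰⊆H⁰⁰⁰) → H⁰⁰ , isH⁰⁰ , H⁰⁰-containedInPowers isH⁰⁰⁰ isH⁰⁰ H⁰⁰⊆H⁰⁰⁰)
      -- From (2) to (1) by way of (3), with `H⁰⁰⁰` itself as the witness.
      (λ c → H⁰⁰⁰ , containedInPowers⇒H⁰⁰ isH⁰⁰⁰ (two⇒three c) , ≐-refl) ,
  mk⇔ two⇒three
      (λ c → H⁰⁰⁰ , containedInPowers⇒H⁰⁰ isH⁰⁰⁰ c , c)
  where
  open DefinableGroupTheory G using (IsH⁰⁰)
  open Approximate em ext ℭ κ monster G X X-definable X-approximate

  -- The same exponent works, since `H⁰⁰⁰` is always contained in `H⁰⁰`.
  two⇒three : (∃ λ H⁰⁰ → IsH⁰⁰ κ H H⁰⁰ × ContainedInPowers H⁰⁰) → ContainedInPowers H⁰⁰⁰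
  two⇒three (H⁰⁰ , ((H⁰⁰-bounded , H⁰⁰-typeDefinable) , _) , m , m≥1 , H⁰⁰⊆) =
    m , m≥1 , λ Y Y-def Y⊆H Y-generic Y-sym {x} x∈ →
      H⁰⁰⊆ Y Y-def Y⊆H Y-generic Y-sym (H⁰⁰⁰⊆typeDefinable isH⁰⁰⁰ H⁰⁰-bounded H⁰⁰-typeDefinable x∈)
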